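{- Let $n\ge 1$. The Hrushovski limit $M_n^0$ is a building of type $A_{\infty,n+1}$ all of whose residues have cardinality $\aleph_0$. That is, the set $\Delta$ of maximal flags of $M_n^0$, with the function $\delta:\Delta^2\to W$ described in the context (which is in particular well-defined), is a building of type $A_{\infty,n+1}$, and for every $s\in\{t_0,\dots,t_n\}$ every equivalence class of $\sim_s$ has cardinality $\aleph_0$.
   Context: Graphs. An $L_n$-graph is an (undirected) graph with edge relation $E$ whose vertex set is partitioned into $V_0,\dots,V_n$ (vertices in $V_i$ are "of type $V_i$"), such that every edge joins a vertex of type $V_{i-1}$ to a vertex of type $V_i$ for some $1\le i\le n$. A path is a sequence of vertices in which consecutive vertices are joined by an edge; its length is its number of edges. A simple cycle $(a,b,\dots,b',a)$ is a closed path with no repeated vertices except the coinciding endpoints (and $b\neq b'$). An $E_i$-cycle is a simple cycle in $V_{i-1}\cup V_i$. An $L_n$-graph is $E_i$-connected if the induced graph on its vertices of types $V_{i-1}$ and $V_i$ is connected (the empty graph counts as connected). Incidence. For $i\le j$, a vertex $x_i$ of type $V_i$ and a vertex $x_j$ of type $V_j$ are incident if there is a sequence $(x_i,x_{i+1},\dots,x_j)$ with $x_l$ of type $V_l$ and $E(x_{l-1},x_l)$ for $l=i+1,\dots,j$ (so a vertex is incident with itself); such a sequence is called a dense flag. A flag is a sequence of distinct pairwise incident vertices; a maximal flag consists of one vertex of each type $V_0,\dots,V_n$. $R(x)$ is the set of vertices incident with $x$. Vertices $x,y$ intersect in the vertex $z$ if the set of type-$V_0$ vertices incident with both $x$ and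 $y$ equals the set of type-$V_0$ vertices incident with $z$; they intersect in the empty set if no type-$V_0$ vertex is incident with both. Dually, with $V_n$ in place of $V_0$, one says that $x,y$ generate the vertex $z$, respectively the empty set. The class $\mathcal K_n$ consists of the finite $L_n$-graphs $A$ such that: (1) $A$ contains no $E_i$-cycles, $i=1,\dots,n$; (2) any $a\ne a'$ in $A$ intersect (in $A$) in a vertex of $A$ or the empty set; (3) any $a\neq a'$ in $A$ generate (in $A$) a vertex of $A$ or the empty set; (4) if $a\in V_i$, $b,b'\in V_{i-1}$ and $\gamma=(a,b,\dots,b',a)$ is a simple cycle of length $k$ contained in $V_h\cup\dots\cup V_i$, $h\le i-2$, then there is a path from $b$ to $b'$ of length at most $k-1$ in $R(a)\cap(V_h\cup\dots\cup V_{i-1})$ all of whose $V_h$-vertices occur in $\gamma$; (5) if $a\in V_i$, $b,b'\in V_{i+1}$ and $\gamma=(a,b,\dots,b',a)$ is a simple cycle of length $k$ contained in $V_i\cup\dots\cup V_h$, $h\ge i+2$, then there is a path from $b$ to $b'$ of length at most $k-1$ in $R(a)\cap(V_{i+1}\cup\dots\cup V_h)$ all of whose $V_h$-vertices occur in $\gamma$. The class $\mathcal K_n'$ consists of those $A\in\mathcal K_n$ which are $E_i$-connected for $i=1,\dots,n$ and in which for every $a\in A$ the residue $R(a)$ is $E_i$-connected for $i=1,\dots,n$. Strong extensions. For a finite $L_n$-graph $A$ which is $E_i$-connected for all $i$ and contains a vertex of each of the types $V_1,\dots,V_{n-1}$ (and is nonempty), the elementary strong extensions of $A$ are: (1) add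 a vertex of type $V_0$ or $V_n$ connected to at most one vertex of $A$ such that the extension is still $E_i$-connected for all $i=1,\dots,n$; (2) if $(x,y,z)$ is a dense flag in $A$, add a vertex $y'$ of the same type as $y$ connected to exactly $x$ and $z$, so that $(x,y',z)$ is a flag. Write $A\le B$ if $B$ arises from $A$ by finitely many elementary strong extensions. $M_n^0$ is the (countable) Hrushovski limit of $(\mathcal K_n',\le)$: $M_n^0=\bigcup_i A_i$ for a chain $A_0\le A_1\le\cdots$ of members of $\mathcal K_n'$, where $A_0$ is a maximal flag, such that whenever $A\in\mathcal K'_n$ is nonempty and contains a flag of type $(V_1,\dots,V_{n-1})$, $A\le A_i$ and $A\le C\in\mathcal K_n'$, there are $j\ge i$ and an embedding $g:C\to A_j$ that is the identity on $A$ with $g(C)\le A_j$. Buildings. Let $W=\langle t_0,\dots,t_n : t_i^2=(t_it_k)^2=1,\ 0\le i,k\le n,\ |k-i|\ge 2\rangle$ and $S=\{t_0,\dots,t_n\}$; its Coxeter diagram is called $A_{\infty,n+1}$. A building of type $A_{\infty,n+1}$ is a set $\Delta$ with a function $\delta:\Delta^2\to W$ such that: (1) for each $s\in S$ the relation $x\sim_s y:\Leftrightarrow\delta(x,y)\in\{1,s\}$ is an equivalence relation on $\Delta$ each of whose classes has at least $2$ elements; (2) whenever $w=r_1\cdots r_k$ is a shortest representation of $w\in W$ with $r_i\in S$ and $x,y\in\Delta$, then $\delta(x,y)=w$ if and only if there is a sequence $x=x_0,x_1,\dots,x_k=y$ in $\Delta$ with $x_{i-1}\ne x_i$ and $\delta(x_{i-1},x_i)=r_i$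 for $i=1,\dots,k$. $M_n^0$ as a building. $\Delta$ is the set of maximal flags of $M_n^0$. Put $\delta(x,x)=1$, put $\delta(x,y)=t_i$ if and only if the maximal flags $x,y$ differ exactly in their vertex of type $V_i$, and for a reduced word $w=r_1\cdots r_k$ put $\delta(x,y)=w$ if and only if there are $x=x_0,x_1,\dots,x_k=y$ in $\Delta$ with $x_{i-1}\neq x_i$ and $\delta(x_{i-1},x_i)=r_i$ for all $i$. -}

module Defs where

open import Algebra.Bundles using (Group)
open import Data.Fin.Base using (Fin; toℕ)
open import Data.Fin.Subset using (Subset; ⁅_⁆; _∪_; Nonempty)
  renaming (_∈_ to _∈ₛ_; _∉_ to _∉ₛ_; ⊤ to full)
open import Data.List.Base using (List; []; _∷_; [_]; _++_; length; reverse)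
open import Data.List.Membership.Propositional using (_∈_)
import Data.List.Properties as Listₚ
open import Data.List.Relation.Unary.All using (All)
open import Data.List.Relation.Unary.Unique.Propositional using (Unique)
open import Data.Nat.Base using (ℕ; suc; _+_; _∸_; _≤_; _<_; ∣_-_∣)
open import Data.Nat.Properties using (∣-∣-comm)
open import Data.Product.Base using (Σ; ∃; ∃-syntax; _×_; _,_; proj₁)
open import Data.Sum.Base using (_⊎_)
open import Function.Base using (_∘_)
open import Function.Bundles using (_⇔_)
open import Function.Definitions using (Injective)
open import Level using (0ℓ)
open import Relation.Binary.Bundles using (Setoid)
open import Relation.Binary.Construct.Closure.ReflexiveTransitive using (Star; ε; _◅_)
open import Relation.Binary.Core using (Rel)
open import Relation.Binary.Definitions using (Decidable; Symmetric)
open import Relation.Binary.Structures using (IsEquivalence)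
open import Relation.Binary.PropositionalEquality
  using (_≡_; _≢_; _≗_; refl; sym; trans; subst; cong)
open import Relation.Nullary.Negation.Core using (¬_)
open import Relation.Unary using (Pred; U)

record LGraph (n : ℕ) (V : Set) : Set₁ where
  field
    type : V → Fin (suc n)
    E    : Rel V 0ℓ

  rank : V → ℕ
  rank v = toℕ (type v)

  field
    E-symmetric : Symmetric E
    E-type      : ∀ {x y} → E x y → rank y ≡ suc (rank x) ⊎ rank x ≡ suc (rank y)

-- Decidability of E is vacuous classically; it lets finite searches be carried out.
record FinLGraph (n : ℕ) : Set₁ where
  field
    size  : ℕ
    graph : LGraph n (Fin size)

  open LGraph graph public

  field
    E? : Decidable E

module _ {n : ℕ} {V : Set} (G : LGraph n V) where
  open LGraph G

  Path : Rel V 0ℓ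
  Path = Star E

  vertices : ∀ {x y} → Path x y → List V
  vertices {x} ε       = [ x ]
  vertices {x} (_ ◅ p) = x ∷ vertices p

  pathLength : ∀ {x y} → Path x y → ℕ
  pathLength ε       = 0
  pathLength (_ ◅ p) = suc (pathLength p)

  -- The cycle (a , b , … , b′ , a); path is its part from b to b′.
  record SimpleCycle (a b b′ : V) : Set where
    field
      first    : E a b
      path     : Path b b′
      last     : E b′ a
      b≢b′     : b ≢ b′
      distinct : Unique (a ∷ vertices path)

    cycleVertices : List V
    cycleVertices = a ∷ vertices path

    cycleLength : ℕ
    cycleLength = 2 + pathLength path

  -- v ∈ V_l ∪ … ∪ V_h
  InLevels : ℕ → ℕ → Pred V 0ℓ
  InLevels l h v = l ≤ rank v × rank v ≤ h

  Connected : Pred V 0ℓ → Set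
  Connected P = ∀ {x y} → P x → P y → Σ (Path x y) λ p → All P (vertices p)

  -- The subgraph induced on P is E_{i+1}-connected for all 0 ≤ i < n.
  EConnected : Pred V 0ℓ → Set
  EConnected P = ∀ i → i < n → Connected (λ v → P v × InLevels i (suc i) v)

  -- Ascending edges; a dense flag from x to y is an element of Star Up x y.
  Up : Rel V 0ℓ
  Up x y = E x y × rank y ≡ suc (rank x)

  Incident : Rel V 0ℓ
  Incident x y = Star Up x y ⊎ Star Up y x

  Residue : V → Pred V 0ℓ
  Residue x v = Incident x v

  -- "x and y intersect in z" for l = 0, "x and y generate z" for l = n.
  MeetIn : ℕ → V → V → V → Set
  MeetIn l x y z = ∀ v → rank v ≡ l → (Incident x v × Incident y v) ⇔ Incident z v

  MeetInEmpty : ℕ → V → V → Set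
  MeetInEmpty l x y = ∀ v → rank v ≡ l → ¬ (Incident x v × Incident y v)

  -- Flags of type (V_{τ 0} , … , V_{τ (m-1)}).
  record Flag {m : ℕ} (τ : Fin m → ℕ) : Set where
    field
      vertex   : Fin m → V
      ofType   : ∀ i → rank (vertex i) ≡ τ i
      distinct : Injective _≡_ _≡_ vertex
      incident : ∀ i j → Incident (vertex i) (vertex j)

  MaximalFlag : Set
  MaximalFlag = Flag {suc n} toℕ

  -- Flags of type (V_1 , … , V_{n-1}).
  InnerFlag : Set
  InnerFlag = Flag {n ∸ 1} (suc ∘ toℕ)

  maximalFlags : Setoid 0ℓ 0ℓ
  maximalFlags = record
    { Carrier       = MaximalFlag
    ; _≈_           = λ x y → Flag.vertex x ≗ Flag.vertex y
    ; isEquivalence = record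
      { refl  = λ _ → refl
      ; sym   = λ p i → sym (p i)
      ; trans = λ p q i → trans (p i) (q i)
      }
    }

  DifferExactlyAt : Fin (suc n) → Rel MaximalFlag 0ℓ
  DifferExactlyAt i x y =
    Flag.vertex x i ≢ Flag.vertex y i × (∀ j → j ≢ i → Flag.vertex x j ≡ Flag.vertex y j)

record InK {n : ℕ} (A : FinLGraph n) : Set where
  open FinLGraph A
  open SimpleCycle
  field
    noECycles : ∀ i → i < n → ∀ {a b b′} (γ : SimpleCycle graph a b b′) →
      ¬ All (InLevels graph i (suc i)) (cycleVertices γ)

    intersect : ∀ {a a′} → a ≢ a′ →
      (∃[ z ] MeetIn graph 0 a a′ z) ⊎ MeetInEmpty graph 0 a a′

    generate : ∀ {a a′} → a ≢ a′ →
      (∃[ z ] MeetIn graph n a a′ z) ⊎ MeetInEmpty graph n a a′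

    -- Here a has type V_{i+1}, so that h ≤ (i + 1) - 2 reads h < i.
    descend : ∀ {a b b′} (γ : SimpleCycle graph a b b′) h i → h < i →
      rank a ≡ suc i → rank b ≡ i → rank b′ ≡ i →
      All (InLevels graph h (suc i)) (cycleVertices γ) →
      Σ (Path graph b b′) λ p →
        pathLength graph p ≤ cycleLength γ ∸ 1 ×
        All (λ v → Residue graph a v × InLevels graph h i v
                   × (rank v ≡ h → v ∈ cycleVertices γ))
            (vertices graph p)

    ascend : ∀ {a b b′} (γ : SimpleCycle graph a b b′) h i → 2 + i ≤ h → h ≤ n →
      rank a ≡ i → rank b ≡ suc i → rank b′ ≡ suc i →
      All (InLevels graph i h) (cycleVertices γ) →
      Σ (Path graph b b′) λ p →
        pathLength graph p ≤ cycleLength γ ∸ 1 ×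
        All (λ v → Residue graph a v × InLevels graph (suc i) h v
                   × (rank v ≡ h → v ∈ cycleVertices γ))
            (vertices graph p)

record InK′ {n : ℕ} (A : FinLGraph n) : Set where
  open FinLGraph A
  field
    inK              : InK A
    connected        : EConnected graph U
    residueConnected : ∀ a → EConnected graph (Residue graph a)

record Embedding {n : ℕ} {V V′ : Set} (G : LGraph n V) (H : LGraph n V′) : Set where
  private
    module G = LGraph G
    module H = LGraph H
  field
    to        : V → V′
    injective : Injective _≡_ _≡_ to
    type-pres : ∀ v → H.type (to v) ≡ G.type v
    E-pres    : ∀ x y → G.E x y ⇔ H.E (to x) (to y)

-- Extensions take place inside B: a set S of vertices stands for the subgraph
-- of B that it induces.

module _ {n : ℕ} (B : FinLGraph n) where
  open FinLGraph B

  record Extendable (S : Subset size) : Set where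
    field
      connected : EConnected graph (_∈ₛ S)
      inner     : ∀ t → 1 ≤ t → t < n → ∃[ v ] v ∈ₛ S × rank v ≡ t
      nonempty  : Nonempty S

  data Elementary (S : Subset size) : Subset size → Set where
    outer : ∀ {v} → Extendable S → v ∉ₛ S →
      rank v ≡ 0 ⊎ rank v ≡ n →
      (∀ {u w} → u ∈ₛ S → w ∈ₛ S → E v u → E v w → u ≡ w) →
      EConnected graph (_∈ₛ (S ∪ ⁅ v ⁆)) →
      Elementary S (S ∪ ⁅ v ⁆)
    inner : ∀ {x y z v} → Extendable S → v ∉ₛ S →
      x ∈ₛ S → y ∈ₛ S → z ∈ₛ S → Up graph x y → Up graph y z →
      type v ≡ type y →
      (∀ {u} → u ∈ₛ S → E v u ⇔ (u ≡ x ⊎ u ≡ z)) →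
      Elementary S (S ∪ ⁅ v ⁆)

Strong : ∀ {n} {A B : FinLGraph n} → Embedding (FinLGraph.graph A) (FinLGraph.graph B) → Set
Strong {B = B} e =
  ∃[ S ] (∀ v → v ∈ₛ S ⇔ (∃[ a ] Embedding.to e a ≡ v)) × Star (Elementary B) S full

record HrushovskiLimit {n : ℕ} {V : Set} (M : LGraph n V) : Set₁ where
  open FinLGraph using (size; graph)
  open Embedding using (to)
  field
    stage        : ℕ → FinLGraph n
    stage∈K′     : ∀ i → InK′ (stage i)
    next         : ∀ i → Embedding (graph (stage i)) (graph (stage (suc i)))
    next-strong  : ∀ i → Strong {A = stage i} {B = stage (suc i)} (next i)

    ι            : ∀ i → Embedding (graph (stage i)) M
    ι-compatible : ∀ i v → to (ι (suc i)) (to (next i) v) ≡ to (ι i) v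
    ι-covers     : ∀ v → ∃[ i ] ∃[ a ] to (ι i) a ≡ v

    stage₀-flag  : Σ (MaximalFlag (graph (stage 0))) λ F →
                     ∀ v → ∃[ i ] Flag.vertex F i ≡ v

    rich : ∀ {A C : FinLGraph n} → InK′ A → Fin (size A) → InnerFlag (graph A) → InK′ C →
      ∀ i (e : Embedding (graph A) (graph (stage i))) → Strong {A = A} {B = stage i} e →
      (f : Embedding (graph A) (graph C)) → Strong {A = A} {B = C} f →
      ∃[ j ] i ≤ j × Σ (Embedding (graph C) (graph (stage j))) λ g →
        (∀ a → to (ι j) (to g (to f a)) ≡ to (ι i) (to e a)) ×
        Strong {A = C} {B = stage j} g

-- The Coxeter group W as a quotient of the free monoid: the generator t_i is the one-letter word [ i ], and
-- words in the generators suffice since each t_i is its own inverse.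

Word : ℕ → Set
Word n = List (Fin (suc n))

infix 4 _≈W_

data _≈W_ {n : ℕ} : Rel (Word n) 0ℓ where
  ≈-refl   : ∀ {u} → u ≈W u
  ≈-sym    : ∀ {u v} → u ≈W v → v ≈W u
  ≈-trans  : ∀ {u v w} → u ≈W v → v ≈W w → u ≈W w
  ≈-cong   : ∀ {u u′ v v′} → u ≈W u′ → v ≈W v′ → u ++ v ≈W u′ ++ v′
  square   : ∀ i → i ∷ i ∷ [] ≈W []
  commute  : ∀ i k → 2 ≤ ∣ toℕ k - toℕ i ∣ → i ∷ k ∷ i ∷ k ∷ [] ≈W []

private
  ≡⇒≈W : ∀ {n} {u v : Word n} → u ≡ v → u ≈W v
  ≡⇒≈W refl = ≈-refl

  reverse-cong : ∀ {n} {u v : Word n} → u ≈W v → reverse u ≈W reverse v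
  reverse-cong ≈-refl        = ≈-refl
  reverse-cong (≈-sym p)     = ≈-sym (reverse-cong p)
  reverse-cong (≈-trans p q) = ≈-trans (reverse-cong p) (reverse-cong q)
  reverse-cong (≈-cong {u} {u′} {v} {v′} p q) =
    ≈-trans (≡⇒≈W (Listₚ.reverse-++ u v))
      (≈-trans (≈-cong (reverse-cong q) (reverse-cong p))
        (≡⇒≈W (sym (Listₚ.reverse-++ u′ v′))))
  reverse-cong (square i)      = square i
  reverse-cong (commute i k d) = commute k i (subst (2 ≤_) (∣-∣-comm (toℕ k) (toℕ i)) d)

  inverseˡ : ∀ {n} (u : Word n) → reverse u ++ u ≈W []
  inverseˡ []      = ≈-refl
  inverseˡ (i ∷ u) = ≈-trans (≡⇒≈W shuffle)
    (≈-trans (≈-cong (≈-refl {u = reverse u}) (≈-cong (square i) (≈-refl {u = u}))) (inverseˡ u))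
    where
    shuffle : reverse (i ∷ u) ++ i ∷ u ≡ reverse u ++ i ∷ i ∷ u
    shuffle = trans (cong (_++ i ∷ u) (Listₚ.unfold-reverse i u))
                    (Listₚ.++-assoc (reverse u) [ i ] (i ∷ u))

  inverseʳ : ∀ {n} (u : Word n) → u ++ reverse u ≈W []
  inverseʳ u = ≈-trans (≡⇒≈W (cong (_++ reverse u) (sym (Listₚ.reverse-involutive u))))
                       (inverseˡ (reverse u))

W : ℕ → Group 0ℓ 0ℓ
W n = record
  { Carrier = Word n
  ; _≈_     = _≈W_
  ; _∙_     = _++_
  ; ε       = []
  ; _⁻¹     = reverse
  ; isGroup = record
    { isMonoid = record
      { isSemigroup = record
        { isMagma = record
          { isEquivalence = record { refl = ≈-refl ; sym = ≈-sym ; trans = ≈-trans }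
          ; ∙-cong        = ≈-cong
          }
        ; assoc = λ u v w → ≡⇒≈W (Listₚ.++-assoc u v w)
        }
      ; identity = (λ _ → ≈-refl) , (λ u → ≡⇒≈W (Listₚ.++-identityʳ u))
      }
    ; inverse = inverseˡ , inverseʳ
    ; ⁻¹-cong = reverse-cong
    }
  }

Reduced : ∀ {n} → Word n → Set
Reduced w = ∀ w′ → w′ ≈W w → length w ≤ length w′

module _ {n : ℕ} (Δ : Setoid 0ℓ 0ℓ)
         (δ : Setoid.Carrier Δ → Setoid.Carrier Δ → Group.Carrier (W n)) where
  open Setoid Δ using (Carrier; _≈_; _≉_)

  data Gallery : Word n → Rel Carrier 0ℓ where
    done : ∀ {x y} → x ≈ y → Gallery [] x y
    step : ∀ {r w x y z} → x ≉ y → δ x y ≈W [ r ] → Gallery w y z → Gallery (r ∷ w) x z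

  GalleryAxiom : Set
  GalleryAxiom = ∀ {w} → Reduced w → ∀ x y → δ x y ≈W w ⇔ Gallery w x y

  Adjacent : Fin (suc n) → Rel Carrier 0ℓ
  Adjacent s x y = δ x y ≈W [] ⊎ δ x y ≈W [ s ]

  record IsBuilding : Set where
    field
      δ-cong       : ∀ {x x′ y y′} → x ≈ x′ → y ≈ y′ → δ x y ≈W δ x′ y′
      adjacent-equ : ∀ s → IsEquivalence (Adjacent s)
      classes≥2    : ∀ s x → ∃[ y ] ∃[ z ] Adjacent s x y × Adjacent s x z × y ≉ z
      galleries    : GalleryAxiom

  AdjacencyClass : Fin (suc n) → Carrier → Setoid 0ℓ 0ℓ
  AdjacencyClass s x = record
    { Carrier       = ∃ (Adjacent s x)
    ; _≈_           = λ p q → proj₁ p ≈ proj₁ q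
    ; isEquivalence = record
      { refl  = Setoid.refl Δ
      ; sym   = Setoid.sym Δ
      ; trans = Setoid.trans Δ
      }
    }

record IsFlagDistance {n : ℕ} {V : Set} (M : LGraph n V)
                      (δ : MaximalFlag M → MaximalFlag M → Group.Carrier (W n)) : Set where
  field
    diagonal   : ∀ x → δ x x ≈W []
    generators : ∀ i x y → δ x y ≈W [ i ] ⇔ DifferExactlyAt M i x y
    reduced    : GalleryAxiom (maximalFlags M) δ

{-# OPTIONS --safe #-}

-- Starting from a maximal flag, each elementary strong extension adds a twin v of a vertex of a maximal
-- flag g of the old graph: the old neighbours of v are the neighbours on g of the vertex of g of the same
-- type. Two flags through v therefore agree in the types adjacent to that of v. So while a gallery runs
-- through flags containing v, its letters commute with the letter i that replaced the i-th vertex by v; in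
-- a gallery of reduced type it cannot enter and leave these flags again. Hence, by induction on the
-- extension, a closed gallery of reduced type is trivial (up to moving letters i to the ends of the word),
-- and this yields the building axioms because a gallery can always be shortened to one of reduced type.
-- The order of the extensions can be changed so that it starts with any given maximal flag x. Thus x is
-- strong in some stage, and richness applied to x with its i-th vertex multiplied k times gives k flags
-- that are i-adjacent to x, for every k.

module Submission where

open import Algebra.Bundles using (Group)
open import Data.Fin.Base as Fin using (Fin; zero; suc; toℕ)
import Data.Fin.Properties as Finₚ
open import Data.Fin.Subset using (Subset; ⁅_⁆; _∪_) renaming (_∈_ to _∈ₛ_; _∉_ to _∉ₛ_)
import Data.Fin.Subset.Properties as Subsetₚ
open import Data.List.Base using ([]; _∷_; [_]; _++_; length; foldr)
open import Data.List.Membership.Propositional using (_∈_)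
import Data.List.Properties as Listₚ
open import Data.List.Relation.Unary.All as All using (All; []; _∷_)
open import Data.List.Relation.Unary.AllPairs using (_∷_)
open import Data.List.Relation.Unary.Any using (here; there)
open import Data.Nat.Base using (ℕ; zero; suc; _+_; _∸_; _⊔_; _≤_; _<_; z≤n; s≤s; ∣_-_∣)
open import Data.Nat.Induction using (<-rec)
import Data.Nat.Properties as ℕₚ
open import Data.Product.Base using (Σ; ∃; ∃-syntax; _×_; _,_; proj₁; proj₂)
open import Data.Sum.Base using (_⊎_; inj₁; inj₂; swap; [_,_]′)
import Data.Vec.Base as Vec
open import Data.Vec.Functional using (updateAt)
open import Data.Vec.Functional.Properties using (updateAt-updates; updateAt-minimal)
import Data.Vec.Properties as Vecₚ
open import Function.Base using (id; _∘_; const; case_of_)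
open import Function.Bundles using (_⇔_; mk⇔; Equivalence; Inverse)
open import Function.Properties.Bijection using (Bijection⇒Inverse)
open import Level using (0ℓ)
open import Relation.Binary.Bundles using (Setoid)
open import Relation.Binary.Construct.Closure.ReflexiveTransitive using (Star; ε; _◅_; _◅◅_; gmap; reverse)
open import Relation.Binary.Core using (Rel)
open import Relation.Binary.Definitions using (DecidableEquality; tri<; tri≈; tri>)
open import Relation.Binary.PropositionalEquality hiding ([_])
open import Relation.Binary.Structures using (IsEquivalence)
open import Relation.Nullary using (¬_; Dec; yes; no; does; contradiction)
open import Relation.Nullary.Decidable
  using (map′; dec-true; decidable-stable; _×-dec_; _⊎-dec_; _→-dec_; ¬?)
open import Relation.Unary using (Pred; Decidable; _⊆_; _≐_; U)
open import Defs

-- W has no relation between neighbouring generators. Reduced words for one element therefore differ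
-- only by exchanges of commuting letters, and a word is reduced exactly when such exchanges never
-- bring two equal letters together. Hence galleries need a single geometric move: swapping two
-- consecutive steps of commuting types.
--
-- Triviality of closed reduced galleries passes to a union of stages, because a gallery is finite,
-- and it determines the type of a reduced gallery between two flags up to exchanges. So the
-- distance can be read off from any chosen reduced gallery.
--
-- Reordering is done one vertex at a time: galleries reduce it to a flag adjacent to the starting
-- one, whose new vertex is moved to the front and traded for the vertex it replaces. Richness gives
-- a separate finite family for each k; decidable equality and an enumeration of the vertices turn
-- these into a bijection with ℕ.

Near : ℕ → ℕ → Set
Near a b = b ≡ suc a ⊎ a ≡ suc b

-- A record and not the bare inequality, so that unification recovers `a` and `b`; the order of the
-- difference is the one in `commute`.
record Far (a b : ℕ) : Set where
  constructor mkFar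
  field distance≥2 : 2 ≤ ∣ b - a ∣

open Far

data Compare (a b : ℕ) : Set where
  same : a ≡ b → Compare a b
  near : Near a b → Compare a b
  far  : Far a b → Compare a b

compare : ∀ a b → Compare a b
compare zero          zero          = same refl
compare zero          (suc zero)    = near (inj₁ refl)
compare zero          (suc (suc b)) = far (mkFar (s≤s (s≤s z≤n)))
compare (suc zero)    zero          = near (inj₂ refl)
compare (suc (suc a)) zero          = far (mkFar (s≤s (s≤s z≤n)))
compare (suc a)       (suc b) with compare a b
... | same p         = same (cong suc p)
... | near (inj₁ p)  = near (inj₁ (cong suc p))
... | near (inj₂ p)  = near (inj₂ (cong suc p))
... | far (mkFar p) = far (mkFar p)

far-irrefl : ∀ {a b} → Far a b → a ≢ b
far-irrefl {a} p refl = contradiction (subst (2 ≤_) (ℕₚ.∣n-n∣≡0 a) (distance≥2 p)) λ ()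

far-sym : ∀ {a b} → Far a b → Far b a
far-sym {a} {b} (mkFar p) = mkFar (subst (2 ≤_) (ℕₚ.∣-∣-comm b a) p)

dist-suc : ∀ a → ∣ suc a - a ∣ ≡ 1
dist-suc zero    = refl
dist-suc (suc a) = dist-suc a

far⇒¬near : ∀ {a b} → Far a b → ¬ Near a b
far⇒¬near {a} p (inj₁ refl) =
  contradiction (subst (2 ≤_) (dist-suc a) (distance≥2 p)) λ { (s≤s ()) }
far⇒¬near p (inj₂ refl) = far⇒¬near (far-sym p) (inj₁ refl)

near⇒≢ : ∀ {a b} → Near a b → a ≢ b
near⇒≢ (inj₁ p) refl = ℕₚ.1+n≢n (sym p)
near⇒≢ (inj₂ p) refl = ℕₚ.1+n≢n (sym p)

near-sym : ∀ {a b} → Near a b → Near b a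
near-sym = swap

-- The word problem in W

module Words {n : ℕ} where

  private variable
    s t     : Fin (suc n)
    u v w x : Word n

  Comm : Rel (Fin (suc n)) 0ℓ
  Comm s t = Far (toℕ s) (toℕ t)

  ¬comm-refl : ∀ s → ¬ Comm s s
  ¬comm-refl s c = far-irrefl c refl

  infix 4 _~_
  -- Equality in the free partially commutative monoid. Symmetry is derived, since `Comm` is
  -- symmetric.
  data _~_ : Rel (Word n) 0ℓ where
    ~-refl   : u ~ u
    ~-trans  : u ~ v → v ~ w → u ~ w
    ~-cons   : ∀ s → u ~ v → s ∷ u ~ s ∷ v
    exchange : Comm s t → s ∷ t ∷ u ~ t ∷ s ∷ u

  ~-sym : u ~ v → v ~ u
  ~-sym ~-refl        = ~-refl
  ~-sym (~-trans p q) = ~-trans (~-sym q) (~-sym p)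
  ~-sym (~-cons s p)  = ~-cons s (~-sym p)
  ~-sym (exchange c) = exchange (far-sym c)

  ≡⇒~ : u ≡ v → u ~ v
  ≡⇒~ refl = ~-refl

  ~-length : u ~ v → length u ≡ length v
  ~-length ~-refl        = refl
  ~-length (~-trans p q) = trans (~-length p) (~-length q)
  ~-length (~-cons s p)  = cong suc (~-length p)
  ~-length (exchange c)  = refl

  exchange-≈W : ∀ s t → Comm s t → s ∷ t ∷ [] ≈W t ∷ s ∷ []
  exchange-≈W s t c =
    ≈-trans (≈-cong (≈-refl {u = s ∷ t ∷ []}) (≈-sym squares))
            (≈-cong (commute s t (distance≥2 c)) (≈-refl {u = t ∷ s ∷ []}))
    where
    squares : s ∷ t ∷ t ∷ s ∷ [] ≈W []
    squares = ≈-trans (≈-cong (≈-refl {u = [ s ]}) (≈-cong (square t) (≈-refl {u = [ s ]}))) (square s)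

  ~⇒≈W : u ~ v → u ≈W v
  ~⇒≈W ~-refl        = ≈-refl
  ~⇒≈W (~-trans p q) = ≈-trans (~⇒≈W p) (~⇒≈W q)
  ~⇒≈W (~-cons s p)  = ≈-cong (≈-refl {u = [ s ]}) (~⇒≈W p)
  ~⇒≈W (exchange {s} {t} c) = ≈-cong (exchange-≈W s t c) ≈-refl

  -- `Pull s w u` moves the first occurrence of `s` in `w` to the front, leaving `u`. The letters
  -- before it commute with `s`, hence differ from it, which makes `u` unique.
  data Pull (s : Fin (suc n)) : Rel (Word n) 0ℓ where
    here  : Pull s (s ∷ u) u
    there : Comm s t → Pull s w u → Pull s (t ∷ w) (t ∷ u)

  pull-functional : Pull s w u → Pull s w v → u ≡ v
  pull-functional here        here        = refl
  pull-functional {s} here    (there c _) = contradiction c (¬comm-refl s)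
  pull-functional {s} (there c _) here    = contradiction c (¬comm-refl s)
  pull-functional (there _ p) (there _ q) = cong (_ ∷_) (pull-functional p q)

  pull? : ∀ s w → Dec (∃ (Pull s w))
  pull? s []      = no λ ()
  pull? s (t ∷ w) with compare (toℕ s) (toℕ t)
  ... | same p with refl ← Finₚ.toℕ-injective p = yes (w , here)
  ... | near p = no λ { (_ , here) → near⇒≢ p refl ; (_ , there c _) → far⇒¬near c p }
  ... | far c  = map′ (λ (u , p) → t ∷ u , there c p)
                      (λ { (_ , here) → contradiction c (¬comm-refl s) ; (_ , there _ p) → _ , p })
                      (pull? s w)

  pull⇒~ : Pull s w u → w ~ s ∷ u
  pull⇒~ here = ~-refl
  pull⇒~ (there {t = t} c p) = ~-trans (~-cons t (pull⇒~ p)) (exchange (far-sym c))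

  -- Left cancellation: exchanges change neither which letters can be moved to the front nor, up to
  -- exchanges, what remains.
  ~-pull : w ~ v → Pull s w u → ∃[ x ] Pull s v x × u ~ x
  ~-pull ~-refl        p = _ , p , ~-refl
  ~-pull (~-trans e f) p =
    let _ , q , g = ~-pull e p
        _ , r , h = ~-pull f q
    in _ , r , ~-trans g h
  ~-pull (~-cons t e) here        = _ , here , e
  ~-pull (~-cons t e) (there c p) =
    let _ , q , g = ~-pull e p in _ , there c q , ~-cons t g
  ~-pull (exchange c) here                   = _ , there c here , ~-refl
  ~-pull (exchange c) (there _ here)         = _ , here , ~-refl
  ~-pull (exchange c) (there d (there d′ p)) = _ , there d′ (there d p) , exchange c

  -- No letter can be moved up to an earlier copy of itself, so nothing cancels even after
  -- exchanges.
  data Irreducible : Word n → Set where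
    []  : Irreducible []
    _∷_ : ¬ ∃ (Pull s w) → Irreducible w → Irreducible (s ∷ w)

  irr-tail : Irreducible (s ∷ w) → Irreducible w
  irr-tail (_ ∷ r) = r

  irr-~ : u ~ v → Irreducible u → Irreducible v
  irr-~ ~-refl        r       = r
  irr-~ (~-trans e f) r       = irr-~ f (irr-~ e r)
  irr-~ (~-cons s e)  (p ∷ r) = (λ (_ , q) → p (_ , proj₁ (proj₂ (~-pull (~-sym e) q)))) ∷ irr-~ e r
  irr-~ (exchange c)  (p ∷ (q ∷ r)) =
    (λ { (_ , here) → ¬comm-refl _ c ; (_ , there _ d) → q (_ , d) })
    ∷ ((λ (_ , d) → p (_ , there c d)) ∷ r)

  irr-pull : Irreducible w → Pull s w u → Irreducible (s ∷ u)
  irr-pull r p = irr-~ (pull⇒~ p) r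

  pull-++ : Pull s w u → ∀ v → Pull s (w ++ v) (u ++ v)
  pull-++ here        v = here
  pull-++ (there c p) v = there c (pull-++ p v)

  irr-prefix : ∀ u v → Irreducible (u ++ v) → Irreducible u
  irr-prefix []      v r       = []
  irr-prefix (s ∷ u) v (p ∷ r) = (λ (_ , q) → p (_ , pull-++ q v)) ∷ irr-prefix u v r

  push : Fin (suc n) → Word n → Word n
  push s w with pull? s w
  ... | yes (u , _) = u
  ... | no _        = s ∷ w

  push-pull : Pull s w u → push s w ≡ u
  push-pull {s} {w} p with pull? s w
  ... | yes (_ , q) = pull-functional q p
  ... | no ¬q       = contradiction (_ , p) ¬q

  push-cons : ¬ ∃ (Pull s w) → push s w ≡ s ∷ w
  push-cons {s} {w} ¬p with pull? s w
  ... | yes p = contradiction p ¬p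
  ... | no _  = refl

  push-~ : ∀ s → u ~ v → push s u ~ push s v
  push-~ {u} {v} s e with pull? s u
  ... | yes (_ , p) = let _ , q , f = ~-pull e p in ~-trans f (≡⇒~ (sym (push-pull q)))
  ... | no ¬p = ~-trans (~-cons s e) (≡⇒~ (sym (push-cons λ (_ , q) →
                  ¬p (_ , proj₁ (proj₂ (~-pull (~-sym e) q))))))

  push-irr : ∀ s → Irreducible w → Irreducible (push s w)
  push-irr {w} s r with pull? s w
  ... | yes (_ , p) = irr-tail (irr-pull r p)
  ... | no ¬p       = ¬p ∷ r

  -- If `s` cancels, irreducibility ensures that no second `s` can be pulled from what remains, so
  -- the next push restores the first.
  push-involutive : ∀ s → Irreducible w → push s (push s w) ~ w
  push-involutive {w} s r with pull? s w
  ... | no ¬p       = ≡⇒~ (push-pull {s} here)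
  ... | yes (_ , p) with irr-pull r p
  ...   | ¬q ∷ _ = ~-trans (≡⇒~ (push-cons ¬q)) (~-sym (pull⇒~ p))

  push-past : ∀ s t → Comm s t → push s (t ∷ w) ~ t ∷ push s w
  push-past {w} s t c with pull? s w
  ... | yes (_ , p) = ≡⇒~ (push-pull (there c p))
  ... | no ¬p       = ~-trans (≡⇒~ (push-cons ¬q)) (exchange c)
    where
    ¬q : ¬ ∃ (Pull s (t ∷ w))
    ¬q (_ , here)      = ¬comm-refl s c
    ¬q (_ , there _ q) = ¬p (_ , q)

  push-comm : ∀ s t → Comm s t → ∀ w → push s (push t w) ~ push t (push s w)
  push-comm s t c w with pull? t w
  ... | yes (u , p) = ~-sym (~-trans (push-~ t (~-trans (push-~ s (pull⇒~ p)) (push-past s t c)))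
                        (≡⇒~ (push-pull {t} here)))
  ... | no ¬p = ~-trans (push-past s t c) (≡⇒~ (sym (push-cons ¬q)))
    where
    ¬q : ¬ ∃ (Pull t (push s w))
    ¬q (_ , q) with pull? s w
    ... | yes (_ , r) = ¬p (_ , proj₁ (proj₂ (~-pull (~-sym (pull⇒~ r)) (there (far-sym c) q))))
    ¬q (_ , here)      | no _ = ¬comm-refl s c
    ¬q (_ , there _ q) | no _ = ¬p (_ , q)

  act : Word n → Word n → Word n
  act u w = foldr push w u

  act-irr : ∀ u → Irreducible w → Irreducible (act u w)
  act-irr []      r = r
  act-irr (s ∷ u) r = push-irr s (act-irr u r)

  act-~ : ∀ u → v ~ w → act u v ~ act u w
  act-~ []      e = e
  act-~ (s ∷ u) e = push-~ s (act-~ u e)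

  -- Van der Waerden's argument: the operators `push s` on irreducible words modulo exchanges
  -- satisfy the defining relations, so the action of words factors through W.
  act-≈W : u ≈W v → Irreducible w → act u w ~ act v w
  act-≈W ≈-refl        r = ~-refl
  act-≈W (≈-sym p)     r = ~-sym (act-≈W p r)
  act-≈W (≈-trans p q) r = ~-trans (act-≈W p r) (act-≈W q r)
  act-≈W {w = w} (≈-cong {u} {u′} {v} {v′} p q) r
    rewrite Listₚ.foldr-++ push w u v | Listₚ.foldr-++ push w u′ v′ =
    ~-trans (act-≈W p (act-irr v r)) (act-~ u′ (act-≈W q r))
  act-≈W (square i) r = push-involutive i r
  act-≈W {w = w} (commute i k c) r =
    ~-trans (push-~ i (push-comm k i (far-sym (mkFar c)) (push k w)))
      (~-trans (push-involutive i (push-irr k (push-irr k r))) (push-involutive k r))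

  normalForm : Word n → Word n
  normalForm u = act u []

  normalForm-irr : Irreducible w → normalForm w ≡ w
  normalForm-irr []                = refl
  normalForm-irr (_∷_ {s = s} p r) = trans (cong (push s) (normalForm-irr r)) (push-cons p)

  -- Acting on the empty word, an irreducible word produces itself, so its class modulo exchanges
  -- depends only on its element of W.
  irreducible-≈W⇒~ : Irreducible u → Irreducible v → u ≈W v → u ~ v
  irreducible-≈W⇒~ r r′ e =
    subst₂ _~_ (normalForm-irr r) (normalForm-irr r′) (act-≈W e [])

  push-length : ∀ s w → length (push s w) ≤ suc (length w)
  push-length s w with pull? s w
  ... | no _        = ℕₚ.≤-refl
  ... | yes (u , p) = ℕₚ.≤-trans (ℕₚ.m≤n+m (length u) 2) (s≤s (ℕₚ.≤-reflexive (sym (~-length (pull⇒~ p)))))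

  normalForm-length : ∀ u → length (normalForm u) ≤ length u
  normalForm-length []      = z≤n
  normalForm-length (s ∷ u) = ℕₚ.≤-trans (push-length s (normalForm u)) (s≤s (normalForm-length u))

  irreducible⇒reduced : Irreducible w → Reduced w
  irreducible⇒reduced {w} r w′ e = subst (_≤ length w′)
    (trans (~-length (act-≈W e [])) (cong length (normalForm-irr r))) (normalForm-length w′)

  -- A failure of irreducibility exhibits two equal letters that exchanges make neighbours; they
  -- cancel.
  shorten : ∀ w → Irreducible w ⊎ ∃[ u ] u ≈W w × length u < length w
  shorten []      = inj₁ []
  shorten (s ∷ w) with shorten w
  ... | inj₂ (u , e , l) = inj₂ (s ∷ u , ≈-cong (≈-refl {u = [ s ]}) e , s≤s l)
  ... | inj₁ r with pull? s w
  ...   | no ¬p       = inj₁ (¬p ∷ r)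
  ...   | yes (u , p) = inj₂ (u
            , ≈-sym (≈-trans (~⇒≈W (~-cons s (pull⇒~ p))) (≈-cong (square s) ≈-refl))
            , ℕₚ.≤-trans (ℕₚ.≤-reflexive (sym (~-length (pull⇒~ p)))) (ℕₚ.n≤1+n _))

  reduced⇒irreducible : Reduced w → Irreducible w
  reduced⇒irreducible {w} red with shorten w
  ... | inj₁ r           = r
  ... | inj₂ (u , e , l) = contradiction l (ℕₚ.≤⇒≯ (red u e))

-- Maximal flags and galleries

module Flags {n : ℕ} {V : Set} (G : LGraph n V) where

  open LGraph G
  open module F {m : ℕ} {τ : Fin m → ℕ} = Flag {n} {V} {G} {m} {τ} using (vertex; ofType; incident) public

  -- Wrapped in a record because flags cannot be inferred from an equality of their vertex
  -- functions; likewise for `Adj`.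
  infix 4 _≋_
  record _≋_ (x y : MaximalFlag G) : Set where
    constructor mk≋
    field at : vertex x ≗ vertex y

  ≋-refl : ∀ {x} → x ≋ x
  ≋-refl = mk≋ λ _ → refl

  ≋-sym : ∀ {x y} → x ≋ y → y ≋ x
  ≋-sym (mk≋ p) = mk≋ λ i → sym (p i)

  ≋-trans : ∀ {x y z} → x ≋ y → y ≋ z → x ≋ z
  ≋-trans (mk≋ p) (mk≋ q) = mk≋ λ i → trans (p i) (q i)

  record Adj (i : Fin (suc n)) (x y : MaximalFlag G) : Set where
    constructor mkAdj
    field
      differ : vertex x i ≢ vertex y i
      agree  : ∀ j → j ≢ i → vertex x j ≡ vertex y j

  up-rank : ∀ {u v} → Star (Up G) u v → rank u ≤ rank v
  up-rank ε             = ℕₚ.≤-refl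
  up-rank ((_ , p) ◅ q) = ℕₚ.≤-trans (ℕₚ.n≤1+n _) (ℕₚ.≤-trans (ℕₚ.≤-reflexive (sym p)) (up-rank q))

  up-equal : ∀ {u v} → Star (Up G) u v → rank u ≡ rank v → u ≡ v
  up-equal ε             _ = refl
  up-equal ((_ , p) ◅ q) r = contradiction (up-rank q) (ℕₚ.<⇒≱ (ℕₚ.≤-reflexive (trans (cong suc (sym r)) (sym p))))

  up-edge : ∀ {u v} → Star (Up G) u v → rank v ≡ suc (rank u) → E u v
  up-edge ε             r = contradiction (sym r) ℕₚ.1+n≢n
  up-edge ((e , p) ◅ q) r with refl ← up-equal q (trans p (sym r)) = e

  type-vertex : ∀ (x : MaximalFlag G) i → type (vertex x i) ≡ i
  type-vertex x i = Finₚ.toℕ-injective (ofType x i)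

  edge-up : ∀ (x : MaximalFlag G) i j → toℕ j ≡ suc (toℕ i) → E (vertex x i) (vertex x j)
  edge-up x i j p with incident x i j
  ... | inj₁ q = up-edge q (trans (ofType x j) (trans p (cong suc (sym (ofType x i)))))
  ... | inj₂ q = contradiction (up-rank q)
                   (ℕₚ.<⇒≱ (ℕₚ.≤-reflexive (trans (cong suc (ofType x i)) (trans (sym p) (sym (ofType x j))))))

  edge : ∀ (x : MaximalFlag G) i j → Near (toℕ i) (toℕ j) → E (vertex x i) (vertex x j)
  edge x i j (inj₁ p) = edge-up x i j p
  edge x i j (inj₂ p) = E-symmetric (edge-up x j i p)

  -- Ascending edges concatenate to dense flags, so edges between consecutive types already make all
  -- vertices incident. A replaced vertex thus has to be checked only against its neighbours in the
  -- flag.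
  mkFlag : (f : Fin (suc n) → V) → (∀ i → rank (f i) ≡ toℕ i) →
           (∀ i j → toℕ j ≡ suc (toℕ i) → E (f i) (f j)) → MaximalFlag G
  mkFlag f r e = record
    { vertex   = f
    ; ofType   = r
    ; distinct = λ {i} {j} p → Finₚ.toℕ-injective (trans (sym (r i)) (trans (cong rank p) (r j)))
    ; incident = inc
    }
    where
    chain : ∀ d i j → toℕ j ≡ d + toℕ i → Star (Up G) (f i) (f j)
    chain zero    i j p with refl ← Finₚ.toℕ-injective p = ε
    chain (suc d) i j p =
      (e i k k≡ , trans (r k) (trans k≡ (cong suc (sym (r i))))) ◅
      chain d k j (trans p (trans (sym (ℕₚ.+-suc d (toℕ i))) (cong (d +_) (sym k≡))))
      where
      i<n : suc (toℕ i) < suc n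
      i<n = ℕₚ.≤-<-trans (ℕₚ.≤-trans (s≤s (ℕₚ.m≤n+m (toℕ i) d)) (ℕₚ.≤-reflexive (sym p))) (Finₚ.toℕ<n j)
      k  = Fin.fromℕ< i<n
      k≡ = Finₚ.toℕ-fromℕ< i<n

    inc : ∀ i j → Incident G (f i) (f j)
    inc i j with ℕₚ.≤-total (toℕ i) (toℕ j)
    ... | inj₁ l = inj₁ (chain _ i j (sym (ℕₚ.m∸n+n≡m l)))
    ... | inj₂ l = inj₂ (chain _ j i (sym (ℕₚ.m∸n+n≡m l)))

  module Replace (x : MaximalFlag G) (i : Fin (suc n)) (v : V) (rv : rank v ≡ toℕ i)
                 (ev : ∀ j → Near (toℕ i) (toℕ j) → E v (vertex x j)) where

    private
      f : Fin (suc n) → V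
      f = updateAt (vertex x) i (const v)

    at : f i ≡ v
    at = updateAt-updates i (vertex x)

    off : ∀ j → j ≢ i → f j ≡ vertex x j
    off j = updateAt-minimal j i (vertex x)

    private
      ranks : ∀ j → rank (f j) ≡ toℕ j
      ranks j with j Finₚ.≟ i
      ... | yes refl = trans (cong rank at) rv
      ... | no j≢i   = trans (cong rank (off j j≢i)) (ofType x j)

      edges : ∀ j k → toℕ k ≡ suc (toℕ j) → E (f j) (f k)
      edges j k p with j Finₚ.≟ i | k Finₚ.≟ i
      ... | yes refl | yes refl = contradiction refl (near⇒≢ (inj₁ p))
      ... | yes refl | no k≢i   = subst₂ E (sym at) (sym (off k k≢i)) (ev k (inj₁ p))
      ... | no j≢i   | yes refl = subst₂ E (sym (off j j≢i)) (sym at) (E-symmetric (ev j (inj₂ p)))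
      ... | no j≢i   | no k≢i   = subst₂ E (sym (off j j≢i)) (sym (off k k≢i)) (edge-up x j k p)

    flag : MaximalFlag G
    flag = mkFlag f ranks edges

    adjacent : vertex x i ≢ v → Adj i x flag
    adjacent ne = mkAdj (λ p → ne (trans p at)) λ j j≢i → sym (off j j≢i)

    flag-all : (Q : Pred V 0ℓ) → Q v → (∀ j → j ≢ i → Q (vertex x j)) → ∀ j → Q (f j)
    flag-all Q q qs j with j Finₚ.≟ i
    ... | yes refl = subst Q (sym at) q
    ... | no j≢i   = subst Q (sym (off j j≢i)) (qs j j≢i)

  adj-sym : ∀ {i x y} → Adj i x y → Adj i y x
  adj-sym (mkAdj ne eq) = mkAdj (ne ∘ sym) λ j j≢i → sym (eq j j≢i)

  adj-cong : ∀ {i x x′ y y′} → x ≋ x′ → y ≋ y′ → Adj i x y → Adj i x′ y′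
  adj-cong {i} (mk≋ p) (mk≋ q) (mkAdj ne eq) = mkAdj
    (λ e → ne (trans (p i) (trans e (sym (q i)))))
    (λ j j≢i → trans (sym (p j)) (trans (eq j j≢i) (q j)))

  agree-off⇒≋ : ∀ {i x y} → vertex x i ≡ vertex y i → (∀ j → j ≢ i → vertex x j ≡ vertex y j) → x ≋ y
  agree-off⇒≋ {i} {x} {y} p q = mk≋ agree
    where
    agree : vertex x ≗ vertex y
    agree j with j Finₚ.≟ i
    ... | yes refl = p
    ... | no j≢i   = q j j≢i

  -- A step of type `s` changes nothing next to position `t`, so the `t`-vertex of `z` fits into `x`
  -- as well. The last two components show that `y′` stays inside any set containing `x` and `z`.
  square-completion : ∀ {s t x y z} → Far (toℕ s) (toℕ t) → Adj s x y → Adj t y z →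
    ∃[ y′ ] Adj t x y′ × Adj s y′ z × vertex y′ t ≡ vertex z t × (∀ j → j ≢ t → vertex y′ j ≡ vertex x j)
  square-completion {s} {t} {x} {y} {z} c (mkAdj p p′) (mkAdj q q′) =
    R.flag , R.adjacent (λ e → q (trans (sym (p′ t t≢s)) e))
    , mkAdj (λ e → p (trans (sym (R.off s (t≢s ∘ sym))) (trans e (sym (q′ s (t≢s ∘ sym)))))) agree
    , R.at , R.off
    where
    t≢s : t ≢ s
    t≢s e = far-irrefl c (cong toℕ (sym e))

    neighbour : ∀ j → Near (toℕ t) (toℕ j) → E (vertex z t) (vertex x j)
    neighbour j nr = subst (E (vertex z t)) (trans (sym (q′ j j≢t)) (sym (p′ j j≢s))) (edge z t j nr)
      where
      j≢t : j ≢ t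
      j≢t refl = near⇒≢ nr refl

      j≢s : j ≢ s
      j≢s refl = far⇒¬near (far-sym c) nr

    module R = Replace x t (vertex z t) (ofType z t) neighbour

    agree : ∀ j → j ≢ s → vertex R.flag j ≡ vertex z j
    agree j j≢s with j Finₚ.≟ t
    ... | yes refl = R.at
    ... | no j≢t   = trans (R.off j j≢t) (trans (p′ j j≢s) (q′ j j≢t))

  Within : Pred V 0ℓ → Pred (MaximalFlag G) 0ℓ
  Within Q x = ∀ i → Q (vertex x i)

  -- In contrast to `Gallery`, no distance is mentioned, since it is obtained from these galleries
  -- later; `Q` varies in the induction over extensions.
  data Gal (Q : Pred V 0ℓ) : Word n → Rel (MaximalFlag G) 0ℓ where
    done : ∀ {x y} → Within Q x → x ≋ y → Gal Q [] x y
    step : ∀ {s w x y z} → Within Q x → Adj s x y → Gal Q w y z → Gal Q (s ∷ w) x z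

  open Words {n}

  module _ {Q : Pred V 0ℓ} where

    within-≋ : ∀ {x y} → x ≋ y → Within Q x → Within Q y
    within-≋ (mk≋ p) q i = subst Q (p i) (q i)

    gal-start : ∀ {w x y} → Gal Q w x y → Within Q x
    gal-start (done q _)   = q
    gal-start (step q _ _) = q

    gal-congˡ : ∀ {w x x′ y} → x ≋ x′ → Gal Q w x y → Gal Q w x′ y
    gal-congˡ p (done q r)   = done (within-≋ p q) (≋-trans (≋-sym p) r)
    gal-congˡ p (step q a g) = step (within-≋ p q) (adj-cong p ≋-refl a) g

    gal-congʳ : ∀ {w x y y′} → y ≋ y′ → Gal Q w x y → Gal Q w x y′
    gal-congʳ p (done q r)   = done q (≋-trans r p)
    gal-congʳ p (step q a g) = step q a (gal-congʳ p g)

    gal-snoc : ∀ {w s x y z} → Gal Q w x y → Adj s y z → Within Q z → Gal Q (w ++ [ s ]) x z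
    gal-snoc (done q r)   a q′ = step q (adj-cong (≋-sym r) ≋-refl a) (done q′ ≋-refl)
    gal-snoc (step q b g) a q′ = step q b (gal-snoc g a q′)

    gal-~ : ∀ {w w′ x y} → w ~ w′ → Gal Q w x y → Gal Q w′ x y
    gal-~ ~-refl        g            = g
    gal-~ (~-trans e f) g            = gal-~ f (gal-~ e g)
    gal-~ (~-cons s e)  (step q a g) = step q a (gal-~ e g)
    gal-~ (exchange {s} {t} c) (step {x = x} q a (step {y = y} _ b g)) =
      let x′ , a′ , b′ , at , off = square-completion c a b
      in step q a′ (step (within {x′} at off) b′ g)
      where
      within : ∀ {x′ : MaximalFlag G} → vertex x′ t ≡ vertex y t → (∀ j → j ≢ t → vertex x′ j ≡ vertex x j) → Within Q x′
      within at off j with j Finₚ.≟ t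
      ... | yes refl = subst Q (sym at) (gal-start g t)
      ... | no j≢t   = subst Q (sym (off j j≢t)) (q j)

  gal-mono : ∀ {Q Q′ : Pred V 0ℓ} → Q ⊆ Q′ → ∀ {w x y} → Gal Q w x y → Gal Q′ w x y
  gal-mono f (done q p)   = done (f ∘ q) p
  gal-mono f (step q a g) = step (f ∘ q) a (gal-mono f g)

  module _ (_≟_ : DecidableEquality V) where

    adj-trans : ∀ {i x y z} → Adj i x y → Adj i y z → x ≋ z ⊎ Adj i x z
    adj-trans {i} {x} {y} {z} (mkAdj _ p) (mkAdj _ q) with vertex x i ≟ vertex z i
    ... | yes e = inj₁ (agree-off⇒≋ e λ j j≢i → trans (p j j≢i) (q j j≢i))
    ... | no ne = inj₂ (mkAdj ne λ j j≢i → trans (p j j≢i) (q j j≢i))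

    -- If the first letter can be brought to the front of the shortened rest, two consecutive steps
    -- of the same type arise, and these merge into one or none.
    gal-irreducible : ∀ {Q w x y} → Gal Q w x y → ∃[ u ] Irreducible u × Gal Q u x y
    gal-irreducible (done q p) = [] , [] , done q p
    gal-irreducible (step {s} q a g) with gal-irreducible g
    ... | u , r , g′ with pull? s u
    ...   | no ¬p = s ∷ u , ¬p ∷ r , step q a g′
    ...   | yes (v , p) with gal-~ (pull⇒~ p) g′
    ...     | step _ b h with adj-trans a b
    ...       | inj₁ e = v , irr-tail (irr-pull r p) , gal-congˡ (≋-sym e) h
    ...       | inj₂ c = s ∷ v , irr-pull r p , step q c h

    Rigid : Pred V 0ℓ → Set
    Rigid Q = ∀ {w x y} → Irreducible w → x ≋ y → Gal Q w x y → w ≡ []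

    -- Let the second gallery begin with a step of type `s`. If no `s` can be brought to the front
    -- of `u`, or if the step so obtained leads to a different flag, then an irreducible gallery
    -- beginning with `s` has the same ends as the rest of the second one. By induction an `s` can
    -- be pulled from that rest, against irreducibility. Otherwise the first steps coincide and are
    -- removed.
    gal-unique : ∀ {Q} → Rigid Q → ∀ {u w x y} → Irreducible u → Irreducible w →
                 Gal Q u x y → Gal Q w x y → u ~ w
    gal-unique P ru [] g (done _ e) = ≡⇒~ (P ru e g)
    gal-unique P {u} ru (_∷_ {s = s} ¬p rw) g (step q a h) with pull? s u
    ... | no ¬p′ = contradiction
            (_ , proj₁ (proj₂ (~-pull (gal-unique P (¬p′ ∷ ru) rw (step (gal-start h) (adj-sym a) g) h) here))) ¬p
    ... | yes (v , p′) with gal-~ (pull⇒~ p′) g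
    ...   | step _ b k with adj-trans (adj-sym a) b
    ...     | inj₁ e = ~-trans (pull⇒~ p′)
                (~-cons s (gal-unique P (irr-tail (irr-pull ru p′)) rw (gal-congˡ (≋-sym e) k) h))
    ...     | inj₂ c = contradiction
                (_ , proj₁ (proj₂ (~-pull (gal-unique P (irr-pull ru p′) rw (step (gal-start h) c k) h) here))) ¬p

-- Free constructions over a maximal flag

module Construction {n : ℕ} {V : Set} (G : LGraph n V) where

  open LGraph G
  open Flags G
  open Words {n}
  open Equivalence using () renaming (to to ⇒; from to ⇐)

  Image : MaximalFlag G → Pred V 0ℓ
  Image x v = ∃[ i ] vertex x i ≡ v

  _∪｛_｝ : Pred V 0ℓ → V → Pred V 0ℓ
  (Q ∪｛ v ｝) u = Q u ⊎ u ≡ v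

  -- What an elementary strong extension adds, whether of the first or of the second kind.
  record Twin (Q : Pred V 0ℓ) (g : MaximalFlag G) (v : V) : Set where
    field
      fresh      : ¬ Q v
      within     : Within Q g
      neighbours : ∀ {u} → Q u → E v u ⇔ (∃[ j ] Near (rank v) (toℕ j) × vertex g j ≡ u)

  -- The set is taken up to `≐`, since the same vertices appear as a subset, as a direct image and
  -- as a union.
  data Built (F : MaximalFlag G) : Pred V 0ℓ → Set₁ where
    start : ∀ {Q} → Q ≐ Image F → Built F Q
    add  : ∀ {Q g v Q′} → Built F Q → Twin Q g v → Q′ ≐ Q ∪｛ v ｝ → Built F Q′

  built-resp : ∀ {F Q Q′} → Q′ ≐ Q → Built F Q → Built F Q′
  built-resp (p , q) (start (r , s))    = start (r ∘ p , q ∘ s)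
  built-resp (p , q) (add b t (r , s)) = add b t (r ∘ p , q ∘ s)

  built-within : ∀ {F Q} → Built F Q → Within Q F
  built-within (start (_ , q))    i = q (i , refl)
  built-within (add b _ (_ , q)) i = q (inj₁ (built-within b i))

  type⇒index : ∀ {x : MaximalFlag G} {j v} → vertex x j ≡ v → j ≡ type v
  type⇒index {x} {j} refl = sym (type-vertex x j)

  image-vertex : ∀ F (x : MaximalFlag G) {i} → Image F (vertex x i) → vertex x i ≡ vertex F i
  image-vertex F x {i} (j , e) =
    trans (sym e) (cong (vertex F) (trans (type⇒index {F} e) (type-vertex x i)))

  module Extension {Q Q′ : Pred V 0ℓ} {g : MaximalFlag G} {v : V} (t : Twin Q g v) (Q′≐ : Q′ ≐ Q ∪｛ v ｝) where

    open Twin t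

    i : Fin (suc n)
    i = type v

    old : ∀ {u} → Q′ u → u ≢ v → Q u
    old q u≢v with proj₁ Q′≐ q
    ... | inj₁ q′ = q′
    ... | inj₂ e  = contradiction e u≢v

    old-vertex : ∀ {x j} → Q′ (vertex x j) → j ≢ i → Q (vertex x j)
    old-vertex {x} q j≢i = old q λ e → j≢i (type⇒index {x} e)

    within-old : ∀ x → Within Q′ x → vertex x i ≢ v → Within Q x
    within-old x q x≢v j = old (q j) λ e → x≢v (subst (λ k → vertex x k ≡ v) (type⇒index {x} e) e)

    within⇒≢ : ∀ x → Within Q x → vertex x i ≢ v
    within⇒≢ x q e = fresh (subst Q e (q i))

    same-neighbours : ∀ x → Within Q′ x → vertex x i ≡ v → ∀ {j} → Near (toℕ i) (toℕ j) →
                      vertex x j ≡ vertex g j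
    same-neighbours x q e {j} nr = trans (sym e′) (cong (vertex g) k≡j)
      where
      nbr = ⇒ (neighbours (old-vertex {x} (q j) λ j≡i → near⇒≢ nr (cong toℕ (sym j≡i))))
              (subst (λ u → E u (vertex x j)) e (edge x i j nr))
      e′  = proj₂ (proj₂ nbr)
      k≡j = trans (type⇒index {g} e′) (type-vertex x j)

    -- The vertex of `g` that `v` imitates has all the neighbours of `v` in `x`, so it can take the
    -- place of `v`.
    project : ∀ {x} → Within Q′ x → vertex x i ≡ v → ∃[ x₀ ] Adj i x x₀ × Within Q x₀
    project {x} q e =
      R.flag , R.adjacent (λ p → within⇒≢ g within (trans (sym p) e))
      , R.flag-all Q (within i) (λ j j≢i → old-vertex {x} (q j) j≢i)
      where
      module R = Replace x i (vertex g i) (ofType g i) (λ j nr →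
        subst (E (vertex g i)) (sym (same-neighbours x q e nr)) (edge g i j nr))

  module DecEq (_≟_ : DecidableEquality V) where

    -- Closed galleries after the addition of one twin

    module RigidExtension {Q Q′ : Pred V 0ℓ} {g : MaximalFlag G} {v : V} (t : Twin Q g v) (Q′≐ : Q′ ≐ Q ∪｛ v ｝) where

      open Twin t
      open Extension t Q′≐

      -- `shift` is the parallel gallery in the old set: `v` is replaced throughout by the `i`-th
      -- vertex of `x₀`, which works because every letter commutes with `i`.
      record Stays (w : Word n) (x y : MaximalFlag G) : Set where
        field
          end   : vertex y i ≡ v
          comm  : w ++ [ i ] ~ i ∷ w
          shift : ∀ {x₀} → Within Q x₀ → Adj i x x₀ →
                  ∃[ y₀ ] Adj i y y₀ × Gal Q w x₀ y₀ × vertex y₀ i ≡ vertex x₀ i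

      -- The gallery may run over `v` for a while before its exit, but those letters commute with
      -- `i`. The fields describe the equivalent gallery whose first step is the exit.
      record Leaves (w : Word n) (x y : MaximalFlag G) : Set where
        field
          {rest}  : Word n
          {next}  : MaximalFlag G
          word    : w ~ i ∷ rest
          leave   : Adj i x next
          off     : vertex next i ≢ v
          gallery : Gal Q′ rest next y

      -- While a gallery stays over v, its flags agree in the neighbours of v, so its letters commute with i.
      stays-or-leaves : ∀ {w x y} → vertex x i ≡ v → Gal Q′ w x y → Stays w x y ⊎ Leaves w x y
      stays-or-leaves e (done q p) = inj₁ record
        { end   = trans (sym (_≋_.at p i)) e
        ; comm  = ~-refl
        ; shift = λ {x₀} q₀ a → x₀ , adj-cong p ≋-refl a , done q₀ ≋-refl , refl
        }
      stays-or-leaves {_ ∷ w} {x} e (step {r} {y = z} q a γ) with vertex z i ≟ v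
      ... | no z≢v = inj₂ (leaving r≡i)
        where
        r≡i : r ≡ i
        r≡i with i Finₚ.≟ r
        ... | yes p  = sym p
        ... | no i≢r = contradiction (trans (sym (Adj.agree a i i≢r)) e) z≢v

        leaving : r ≡ i → Leaves (r ∷ w) x _
        leaving refl = record { word = ~-refl ; leave = a ; off = z≢v ; gallery = γ }
      ... | yes z≡v with compare (toℕ i) (toℕ r)
      ...   | same p with refl ← Finₚ.toℕ-injective p = contradiction (trans e (sym z≡v)) (Adj.differ a)
      ...   | near p = contradiction
                (trans (same-neighbours x q e p) (sym (same-neighbours z (gal-start γ) z≡v p))) (Adj.differ a)
      ...   | far c with stays-or-leaves z≡v γ
      ...     | inj₁ s = inj₁ record
                { end   = Stays.end s
                ; comm  = ~-trans (~-cons r (Stays.comm s)) (exchange (far-sym c))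
                ; shift = shift
                }
        where
        i≢r : i ≢ r
        i≢r p = far-irrefl c (cong toℕ p)

        shift : ∀ {x₀} → Within Q x₀ → Adj i x x₀ →
                ∃[ y₀ ] Adj i _ y₀ × Gal Q (r ∷ w) x₀ y₀ × vertex y₀ i ≡ vertex x₀ i
        shift {x₀} q₀ b =
          let z₀ , b′ , a′ , at , off = square-completion c (adj-sym b) a
              q₁ : Within Q z₀
              q₁ j = case j Finₚ.≟ r of λ
                { (yes refl) → subst Q (sym at) (old-vertex {z} (gal-start γ r) (i≢r ∘ sym))
                ; (no j≢r)   → subst Q (sym (off j j≢r)) (q₀ j) }
              y₀ , a″ , γ′ , p = Stays.shift s q₁ (adj-sym a′)
          in y₀ , a″ , step q₀ b′ γ′ , trans p (off i i≢r)
      ...     | inj₂ l = inj₂ (leaving (square-completion (far-sym c) a (Leaves.leave l)))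
        where
        z′ : MaximalFlag G
        z′ = Leaves.next l

        leaving : ∃[ x′ ] Adj i x x′ × Adj r x′ z′ × vertex x′ i ≡ vertex z′ i
                          × (∀ j → j ≢ i → vertex x′ j ≡ vertex x j) →
                  Leaves (r ∷ w) x _
        leaving (x′ , b , a′ , at , off) = record
          { word    = ~-trans (~-cons r (Leaves.word l)) (exchange (far-sym c))
          ; leave   = b
          ; off     = λ p → Leaves.off l (trans (sym at) p)
          ; gallery = step q′ a′ (Leaves.gallery l)
          }
          where
          q′ : Within Q′ x′
          q′ j with j Finₚ.≟ i
          ... | yes refl = subst Q′ (sym at) (gal-start (Leaves.gallery l) i)
          ... | no j≢i   = subst Q′ (sym (off j j≢i)) (q j)

      -- The letter `i` of the entrance and that of the exit would meet after exchanges.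
      ¬leaves-after : ∀ {w x y} → Irreducible (i ∷ w) → ¬ Leaves w x y
      ¬leaves-after (¬p ∷ _) l = ¬p (_ , proj₁ (proj₂ (~-pull (~-sym (Leaves.word l)) here)))

      enters-at-i : ∀ {r x z} → Adj r x z → vertex x i ≢ v → vertex z i ≡ v → r ≡ i
      enters-at-i {r} a x≢v z≡v with i Finₚ.≟ r
      ... | yes p  = sym p
      ... | no i≢r = contradiction (trans (Adj.agree a i i≢r) z≡v) x≢v

      avoids : ∀ {w x y} → Irreducible w → vertex x i ≢ v → vertex y i ≢ v → Gal Q′ w x y → Gal Q w x y
      avoids {x = x} r x≢v y≢v (done q p) = done (within-old x q x≢v) p
      avoids {x = x} (¬p ∷ r) x≢v y≢v (step {y = z} q a γ) with vertex z i ≟ v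
      ... | no z≢v = step (within-old x q x≢v) a (avoids r z≢v y≢v γ)
      ... | yes z≡v with refl ← enters-at-i a x≢v z≡v with stays-or-leaves z≡v γ
      ...   | inj₁ s = contradiction (Stays.end s) y≢v
      ...   | inj₂ l = contradiction l (¬leaves-after (¬p ∷ r))

      -- Once over `v` the gallery stays there, so the entering letter `i` commutes with all later
      -- ones and moves to the end of the word. The part over `v` is shifted so as to start at the
      -- flag before the entrance.
      enters : ∀ {w x y} → Irreducible w → vertex x i ≢ v → vertex y i ≡ v → Gal Q′ w x y →
               ∃[ w′ ] ∃[ y′ ] w ~ w′ ++ [ i ] × Gal Q w′ x y′ × Adj i y′ y
      enters r x≢v y≡v (done q p) = contradiction (trans (_≋_.at p i) y≡v) x≢v
      enters {x = x} (¬p ∷ r) x≢v y≡v (step {s} {y = z} q a γ) with vertex z i ≟ v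
      ... | no z≢v =
            let w′ , y′ , e , δ , b = enters r z≢v y≡v γ
            in s ∷ w′ , y′ , ~-cons s e , step (within-old x q x≢v) a δ , b
      ... | yes z≡v with refl ← enters-at-i a x≢v z≡v with stays-or-leaves z≡v γ
      ...   | inj₂ l = contradiction l (¬leaves-after (¬p ∷ r))
      ...   | inj₁ s =
              let y₀ , b , δ , _ = Stays.shift s (within-old x q x≢v) (adj-sym a)
              in _ , y₀ , ~-sym (Stays.comm s) , δ , adj-sym b

      -- A closed gallery that stays over `v` shifts to a closed old gallery of the same type. One
      -- that leaves `v` has to return, so after exchanges its type is `i`, an old `w′`, and `i`
      -- again, where the ends of the old gallery differ at most in type `i`.
      rigid-extension : Rigid _≟_ Q → Rigid _≟_ Q′
      rigid-extension rigid {w} {x} {y} r x≋y γ with vertex x i ≟ v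
      ... | no x≢v = rigid r x≋y (avoids r x≢v (λ e → x≢v (trans (_≋_.at x≋y i) e)) γ)
      ... | yes x≡v with stays-or-leaves x≡v γ
      ...   | inj₁ s =
              let x₀ , a , q₀ = project (gal-start γ) x≡v
                  y₀ , b , δ , p = Stays.shift s q₀ a
              in rigid r (agree-off⇒≋ {i} (sym p) λ j j≢i →
                   trans (sym (Adj.agree a j j≢i)) (trans (_≋_.at x≋y j) (Adj.agree b j j≢i))) δ
      ...   | inj₂ l
              with w′ , y′ , e , δ , b ←
                   enters (irr-tail (irr-~ (Leaves.word l) r)) (Leaves.off l)
                          (trans (sym (_≋_.at x≋y i)) x≡v) (Leaves.gallery l)
              with irr-~ (~-cons i e) (irr-~ (Leaves.word l) r)
                 | adj-trans _≟_ b (adj-cong x≋y ≋-refl (Leaves.leave l))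
      -- The old gallery is closed, so `w′` is empty and the word becomes `i i`.
      ...     | ¬p ∷ r′ | inj₁ y′≋x′ with refl ← rigid (irr-prefix w′ [ i ] r′) (≋-sym y′≋x′) δ =
                  contradiction (_ , here) ¬p
      -- One step of type `i` closes the old gallery; the resulting type is irreducible but not
      -- empty.
      ...     | _ ∷ r′ | inj₂ c
                with () ← Listₚ.++-conicalʳ w′ [ i ]
                            (rigid r′ ≋-refl (gal-snoc δ c (within-old (Leaves.next l) (gal-start (Leaves.gallery l)) (Leaves.off l))))

    built-rigid : ∀ {F Q} → Built F Q → Rigid _≟_ Q
    built-rigid (start (p , _)) r _ (done _ _) = refl
    built-rigid {F} (start (p , _)) r _ (step {s} {x = x} {y} q a γ) =
      contradiction (trans (image-vertex F x (p (q s))) (sym (image-vertex F y (p (gal-start γ s))))) (Adj.differ a)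
    built-rigid (add b t e) = RigidExtension.rigid-extension t e (built-rigid b)

    -- By `project`, a flag through the newest vertex is one step away from an old flag.
    built-gallery : ∀ {F Q} → Built F Q → ∀ x y → Within Q x → Within Q y → ∃[ w ] Gal Q w x y
    built-gallery {F} (start (p , _)) x y q q′ =
      [] , done q (mk≋ λ s → trans (image-vertex F x (p (q s))) (sym (image-vertex F y (p (q′ s)))))
    built-gallery {Q = Q} (add {Q₀} {v = v} b t e) x y q q′ with vertex x (type v) ≟ v | vertex y (type v) ≟ v
    ... | no x≢v  | no y≢v  =
          let w , γ = built-gallery b x y (within-old x q x≢v) (within-old y q′ y≢v)
          in w , gal-mono (proj₂ e ∘ inj₁) γ
      where open Extension t e
    ... | no x≢v  | yes y≡v =
          let y₀ , a , p = project q′ y≡v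
              w , γ = built-gallery b x y₀ (within-old x q x≢v) p
          in _ , gal-snoc (gal-mono (proj₂ e ∘ inj₁) γ) (adj-sym a) q′
      where open Extension t e
    ... | yes x≡v | no y≢v  =
          let x₀ , a , p = project q x≡v
              w , γ = built-gallery b x₀ y p (within-old y q′ y≢v)
          in _ , step q a (gal-mono (proj₂ e ∘ inj₁) γ)
      where open Extension t e
    ... | yes x≡v | yes y≡v =
          let x₀ , a , p  = project q x≡v
              y₀ , a′ , p′ = project q′ y≡v
              w , γ = built-gallery b x₀ y₀ p p′
          in _ , step q a (gal-snoc (gal-mono (proj₂ e ∘ inj₁) γ) (adj-sym a′) q′)
      where open Extension t e

    -- When `f′` is added, its neighbours lie on `F`, so it is a twin of the vertex of `F` that it
    -- replaces, and conversely. Adding `f′` to `F` gives the same set as adding that vertex to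
    -- `F′`.
    built-exchange : ∀ {F F′ i Q} → Built F Q → Adj i F F′ → Within Q F′ → Built F′ Q
    built-exchange {F} {F′} {i} b a q′ = go b q′
      where
      open Adj a

      f′ : V
      f′ = vertex F′ i

      other : ∀ {j k} → Near (rank (vertex F k)) (toℕ j) → toℕ j ≢ toℕ k
      other {j} {k} nr e = near⇒≢ nr (trans (ofType F k) (sym e))

      twin : Twin (Image F′) F′ (vertex F i)
      twin = record
        { fresh      = differ ∘ image-vertex F′ F
        ; within     = λ j → j , refl
        ; neighbours = λ { {u} (k , refl) → mk⇔
            (λ e → k , subst (Near (rank (vertex F i))) (ofType F′ k) (E-type e) , refl)
            (λ (j , nr , e) → subst (E (vertex F i))
              (trans (agree j (λ j≡i → other {j} {i} nr (cong toℕ j≡i))) e)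
              (edge F i j (subst (λ r → Near r (toℕ j)) (ofType F i) nr))) }
        }

      -- No vertex added earlier is adjacent to f′, so f′ can be added to F before all of them.
      first : ∀ {Q} → Built F Q → Twin Q F f′ → Built F′ (Q ∪｛ f′ ｝)
      first {Q} (start (p , p′)) t = add (start ((λ z → z) , λ z → z)) twin (fwd , bwd)
        where
        fwd : (Q ∪｛ f′ ｝) ⊆ (Image F′ ∪｛ vertex F i ｝)
        fwd (inj₂ refl) = inj₁ (i , refl)
        fwd (inj₁ z) with p z
        ... | j , refl with j Finₚ.≟ i
        ...   | yes refl = inj₂ refl
        ...   | no j≢i   = inj₁ (j , sym (agree j j≢i))

        bwd : (Image F′ ∪｛ vertex F i ｝) ⊆ (Q ∪｛ f′ ｝)
        bwd (inj₂ refl) = inj₁ (p′ (i , refl))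
        bwd (inj₁ (j , refl)) with j Finₚ.≟ i
        ... | yes refl = inj₂ refl
        ... | no j≢i   = inj₁ (p′ (j , agree j j≢i))
      first (add {Q₀} {g} {v} {Q} b t e) s = add (first b s₀) t₀ (fwd , bwd)
        where
        module T = Twin t
        module S = Twin s

        v≢f′ : v ≢ f′
        v≢f′ p = S.fresh (proj₂ e (inj₂ (sym p)))

        s₀ : Twin Q₀ F f′
        s₀ = record
          { fresh      = S.fresh ∘ proj₂ e ∘ inj₁
          ; within     = built-within b
          ; neighbours = S.neighbours ∘ proj₂ e ∘ inj₁
          }

        ¬edge : ¬ E v f′
        ¬edge vf with j , _ , p ← ⇒ (S.neighbours (proj₂ e (inj₂ refl))) (E-symmetric vf) =
          T.fresh (subst Q₀ p (built-within b j))

        t₀ : Twin (Q₀ ∪｛ f′ ｝) g v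
        t₀ = record
          { fresh      = λ { (inj₁ z) → T.fresh z ; (inj₂ p) → v≢f′ p }
          ; within     = inj₁ ∘ T.within
          ; neighbours = λ
              { (inj₁ z)    → T.neighbours z
              ; (inj₂ refl) → mk⇔ (λ vf → contradiction vf ¬edge)
                  (λ (j , _ , p) → contradiction (subst Q p (proj₂ e (inj₁ (T.within j)))) S.fresh) }
          }

        fwd : (Q ∪｛ f′ ｝) ⊆ ((Q₀ ∪｛ f′ ｝) ∪｛ v ｝)
        fwd (inj₂ p) = inj₁ (inj₂ p)
        fwd (inj₁ z) with proj₁ e z
        ... | inj₁ z₀ = inj₁ (inj₁ z₀)
        ... | inj₂ p  = inj₂ p

        bwd : ((Q₀ ∪｛ f′ ｝) ∪｛ v ｝) ⊆ (Q ∪｛ f′ ｝)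
        bwd (inj₁ (inj₁ z)) = inj₁ (proj₂ e (inj₁ z))
        bwd (inj₁ (inj₂ p)) = inj₂ p
        bwd (inj₂ p)        = inj₁ (proj₂ e (inj₂ p))

      go : ∀ {Q} → Built F Q → Within Q F′ → Built F′ Q
      go (start (p , _)) q = contradiction (sym (image-vertex F F′ (p (q i)))) differ
      go {Q} (add {Q₀} {g} {v} b t e) q with f′ ≟ v
      ... | no f′≢v  = add (go b within₀) t e
        where
        within₀ : Within Q₀ F′
        within₀ j with j Finₚ.≟ i
        ... | yes refl = Extension.old t e (q i) f′≢v
        ... | no j≢i   = subst Q₀ (agree j j≢i) (built-within b j)
      ... | yes refl = built-resp e (first b s)
        where
        module T = Twin t

        open Extension t e using (same-neighbours)

        old-F : ∀ j → Near (rank f′) (toℕ j) → vertex g j ≡ vertex F j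
        old-F j nr = trans (sym (same-neighbours F′ q (cong (vertex F′) (type-vertex F′ i)) nr))
          (sym (agree j λ { refl → near⇒≢ nr (ofType F′ i) }))

        s : Twin Q₀ F f′
        s = record
          { fresh      = T.fresh
          ; within     = built-within b
          ; neighbours = λ z → mk⇔
              (λ vu → let j , nr , p = ⇒ (T.neighbours z) vu in j , nr , trans (sym (old-F j nr)) p)
              (λ (j , nr , p) → ⇐ (T.neighbours z) (j , nr , trans (old-F j nr) p))
          }

    built-≋ : ∀ {F F′ Q} → F ≋ F′ → Built F Q → Built F′ Q
    built-≋ (mk≋ f) (start (p , p′)) =
      start ((λ z → let j , e = p z in j , trans (sym (f j)) e) , λ (j , e) → p′ (j , trans (f j) e))
    built-≋ f (add b t e) = add (built-≋ f b) t e

    built-from : ∀ {F Q} → Built F Q → ∀ x → Within Q x → Built x Q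
    built-from {F} {Q} b x q = along b (proj₂ (built-gallery b F x (built-within b) q))
      where
      along : ∀ {w x y} → Built x Q → Gal Q w x y → Built y Q
      along b (done _ e)   = built-≋ e b
      along b (step _ a γ) = along (built-exchange b a (gal-start γ)) γ

  built-flag : ∀ {F Q} → Built F Q → ∀ {u} → Q u → ∃[ x ] Within Q x × vertex x (type u) ≡ u
  built-flag {F} b@(start (p , _)) z with j , refl ← p z =
    F , built-within b , cong (vertex F) (type-vertex F j)
  built-flag (add {Q₀} {g} {v} {Q} b t e) z with proj₁ e z
  ... | inj₁ z₀ = let x , q , p = built-flag b z₀ in x , (λ j → proj₂ e (inj₁ (q j))) , p
  ... | inj₂ refl = R.flag , R.flag-all Q (proj₂ e (inj₂ refl)) (λ j _ → proj₂ e (inj₁ (T.within j))) , R.at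
    where
    module T = Twin t
    module R = Replace g (type v) v refl
      (λ j nr → ⇐ (T.neighbours (T.within j)) (j , nr , refl))

  Joined : Pred V 0ℓ → Rel V 0ℓ
  Joined P = Star (λ u v → P u × P v × E u v)

  joined-sym : ∀ {P u v} → Joined P u v → Joined P v u
  joined-sym = reverse λ (p , q , e) → q , p , E-symmetric e

  joined-mono : ∀ {P P′ u v} → P ⊆ P′ → Joined P u v → Joined P′ u v
  joined-mono f = gmap (λ u → u) λ (p , q , e) → f p , f q , e

  joined⇒path : ∀ {P u v} → P u → Joined P u v → Σ (Path G u v) λ p → All P (vertices G p)
  joined⇒path z ε = ε , z ∷ []
  joined⇒path z ((_ , q , e) ◅ j) = let p , a = joined⇒path q j in e ◅ p , z ∷ a

  star⇒connected : ∀ {P c} → (∀ {u} → P u → Joined P u c) → Connected G P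
  star⇒connected j p q = joined⇒path p (j p ◅◅ joined-sym (j q))

  joined-edge : ∀ {P u v} → P u → P v → E u v → Joined P u v
  joined-edge p q e = (p , q , e) ◅ ε

  Level : Pred V 0ℓ → ℕ → Pred V 0ℓ
  Level Q l v = Q v × InLevels G l (suc l) v

  level-rank : ∀ {l v} → InLevels G l (suc l) v → rank v ≡ l ⊎ rank v ≡ suc l
  level-rank (p , q) with ℕₚ.m≤n⇒m<n∨m≡n p
  ... | inj₂ e  = inj₁ (sym e)
  ... | inj₁ l< = inj₂ (ℕₚ.≤-antisym q l<)

  lower-level : ∀ {l v} → rank v ≡ l → InLevels G l (suc l) v
  lower-level r = ℕₚ.≤-reflexive (sym r) , ℕₚ.≤-trans (ℕₚ.≤-reflexive r) (ℕₚ.n≤1+n _)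

  upper-level : ∀ {l v} → rank v ≡ suc l → InLevels G l (suc l) v
  upper-level r = ℕₚ.≤-trans (ℕₚ.n≤1+n _) (ℕₚ.≤-reflexive (sym r)) , ℕₚ.≤-reflexive r

  -- Each new vertex of the two levels has a neighbour on the older flag `g` in the other level, and
  -- so is joined to the lower vertex of `F`. Elementary extensions demand this connectedness at
  -- every step.
  built-econnected : ∀ {F Q} → Built F Q → EConnected G Q
  built-econnected {F} b l l<n = star⇒connected (joined b)
    where
    i j : Fin (suc n)
    i = Fin.fromℕ< (ℕₚ.m<n⇒m<1+n l<n)
    j = Fin.fromℕ< (s≤s l<n)

    i≡ : toℕ i ≡ l
    i≡ = Finₚ.toℕ-fromℕ< (ℕₚ.m<n⇒m<1+n l<n)

    j≡ : toℕ j ≡ suc l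
    j≡ = Finₚ.toℕ-fromℕ< (s≤s l<n)

    joined : ∀ {Q} → Built F Q → ∀ {u} → Level Q l u → Joined (Level Q l) u (vertex F i)
    joined b@(start (p , _)) {u} (z , lv) with p z
    ... | k , refl with level-rank {l} {u} lv
    ...   | inj₁ r with refl ← Finₚ.toℕ-injective {i = k} {i} (trans (sym (ofType F k)) (trans r (sym i≡))) = ε
    ...   | inj₂ r with refl ← Finₚ.toℕ-injective {i = k} {j} (trans (sym (ofType F k)) (trans r (sym j≡))) =
              joined-edge (z , lv) (built-within b i , lower-level (trans (ofType F i) i≡))
                (edge F j i (inj₂ (trans j≡ (cong suc (sym i≡)))))
    joined {Q} (add {Q₀} {g} {v} b t e) {u} (z , lv) with proj₁ e z
    ... | inj₁ z₀ = joined-mono {Level Q₀ l} {Level Q l} (λ (y , w) → proj₂ e (inj₁ y) , w) (joined b (z₀ , lv))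
    ... | inj₂ refl = via (level-rank {l} {u} lv)
      where
      through : ∀ k → InLevels G l (suc l) (vertex g k) → Near (rank u) (toℕ k) → Joined (Level Q l) u (vertex F i)
      through k lv′ nr =
        joined-edge (z , lv) (proj₂ e (inj₁ (Twin.within t k)) , lv′)
          (⇐ (Twin.neighbours t (Twin.within t k)) (k , nr , refl))
        ◅◅ joined-mono {Level Q₀ l} {Level Q l} (λ (y , w) → proj₂ e (inj₁ y) , w) (joined b (Twin.within t k , lv′))

      via : rank u ≡ l ⊎ rank u ≡ suc l → Joined (Level Q l) u (vertex F i)
      via (inj₁ r) = through j (upper-level (trans (ofType g j) j≡)) (inj₁ (trans j≡ (cong suc (sym r))))
      via (inj₂ r) = through i (lower-level (trans (ofType g i) i≡)) (inj₂ (trans r (cong suc (sym i≡))))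

-- Strong extensions as free constructions

comprehension : ∀ {m} {P : Pred (Fin m) 0ℓ} → Decidable P → Subset m
comprehension P? = Vec.tabulate (does ∘ P?)

∈-comprehension : ∀ {m} {P : Pred (Fin m) 0ℓ} (P? : Decidable P) → (_∈ₛ comprehension P?) ≐ P
∈-comprehension {P = P} P? = to , from
  where
  lookup≡ : ∀ i → Vec.lookup (comprehension P?) i ≡ does (P? i)
  lookup≡ = Vecₚ.lookup∘tabulate (does ∘ P?)

  to : (_∈ₛ comprehension P?) ⊆ P
  to {i} p with P? i | trans (sym (lookup≡ i)) (Vecₚ.[]=⇒lookup p)
  ... | yes q | _ = q

  from : P ⊆ (_∈ₛ comprehension P?)
  from {i} p = Vecₚ.lookup⇒[]= i _ (trans (lookup≡ i) (dec-true (P? i) p))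

-- An end of the diagram has at most one adjacent type, so a twin of type 0 or `n` has at most one
-- old neighbour.
near-extreme : ∀ {n a b c} → a ≡ 0 ⊎ a ≡ n → Near a b → Near a c → b ≤ n → c ≤ n → b ≡ c
near-extreme (inj₁ refl) (inj₂ ())   _           _  _
near-extreme (inj₁ refl) (inj₁ refl) (inj₂ ())   _  _
near-extreme p           (inj₁ refl) (inj₁ refl) _  _  = refl
near-extreme p           (inj₂ refl) (inj₂ refl) _  _  = refl
near-extreme (inj₂ refl) (inj₁ refl) (inj₂ _)    b≤ _  = contradiction b≤ (ℕₚ.<⇒≱ ℕₚ.≤-refl)
near-extreme (inj₂ refl) (inj₂ _)    (inj₁ refl) _  c≤ = contradiction c≤ (ℕₚ.<⇒≱ ℕₚ.≤-refl)

positive : ∀ {n} → 1 ≤ n → ∃[ m ] n ≡ suc m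
positive (s≤s {n = m} _) = m , refl

module StrongExtension {n : ℕ} (1≤n : 1 ≤ n) (B : FinLGraph n) where

  open FinLGraph B
  open Flags graph
  open Construction graph
  open Equivalence using () renaming (to to ⇒; from to ⇐)

  ∈-∪⁅⁆ : ∀ S v → (_∈ₛ (S ∪ ⁅ v ⁆)) ≐ ((_∈ₛ S) ∪｛ v ｝)
  ∈-∪⁅⁆ S v = to , from
    where
    to : (_∈ₛ (S ∪ ⁅ v ⁆)) ⊆ ((_∈ₛ S) ∪｛ v ｝)
    to z with Subsetₚ.x∈p∪q⁻ S ⁅ v ⁆ z
    ... | inj₁ p = inj₁ p
    ... | inj₂ p = inj₂ (Subsetₚ.x∈⁅y⁆⇒x≡y v p)

    from : ((_∈ₛ S) ∪｛ v ｝) ⊆ (_∈ₛ (S ∪ ⁅ v ⁆))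
    from (inj₁ p)    = Subsetₚ.x∈p∪q⁺ (inj₁ p)
    from (inj₂ refl) = Subsetₚ.x∈p∪q⁺ (inj₂ (Subsetₚ.x∈⁅x⁆ v))

  rank≤n : ∀ v → rank v ≤ n
  rank≤n v = ℕₚ.≤-pred (Finₚ.toℕ<n (type v))

  connected⇒neighbour : ∀ {P u v} → Connected graph P → P u → P v → u ≢ v → ∃[ w ] P w × E u w
  connected⇒neighbour c p q ne with c p q
  ... | ε , _               = contradiction refl ne
  ... | e ◅ ε , _ ∷ r ∷ _   = _ , r , e
  ... | e ◅ _ ◅ _ , _ ∷ r ∷ _ = _ , r , e

  -- Connectedness of the extension forces `v` to have a neighbour `u`, so that it has exactly one.
  -- Any old flag through `u` then serves as `g`.
  outer-twin : ∀ {F S v} → Built F (_∈ₛ S) → v ∉ₛ S → rank v ≡ 0 ⊎ rank v ≡ n →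
               (∀ {u w} → u ∈ₛ S → w ∈ₛ S → E v u → E v w → u ≡ w) →
               EConnected graph (_∈ₛ (S ∪ ⁅ v ⁆)) → ∃[ g ] Twin (_∈ₛ S) g v
  outer-twin {F} {S} {v} b v∉S extreme unique conn =
    let u , u∈ , vu = neighbour extreme
        g , within , gu≡u = built-flag b u∈
    in g , record
      { fresh      = v∉S
      ; within     = within
      ; neighbours = λ {w} w∈ → mk⇔
          (λ vw → type u , E-type vu , trans gu≡u (unique u∈ w∈ vu vw))
          (λ (j , nr , gj≡w) → subst (E v)
            (trans (sym gu≡u)
              (trans (cong (vertex g) (Finₚ.toℕ-injective
                       (near-extreme extreme (E-type vu) nr (rank≤n u) (ℕₚ.≤-pred (Finₚ.toℕ<n j)))))
                     gj≡w))
            vu)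
      }
    where
    towards : ∀ l → l < n → InLevels graph l (suc l) v → ∀ k → InLevels graph l (suc l) (vertex F k) →
              rank v ≢ toℕ k → ∃[ u ] u ∈ₛ S × E v u
    towards l l<n lv k lk v≢k
      with u , (u∈ , _) , vu ← connected⇒neighbour (conn l l<n)
             (proj₂ (∈-∪⁅⁆ S v) (inj₂ refl) , lv) (proj₂ (∈-∪⁅⁆ S v) (inj₁ (built-within b k)) , lk)
             (λ v≡ → v≢k (trans (cong rank v≡) (ofType F k)))
      with proj₁ (∈-∪⁅⁆ S v) u∈
    ... | inj₁ u∈S  = u , u∈S , vu
    ... | inj₂ refl = contradiction refl (near⇒≢ (E-type vu))

    neighbour : rank v ≡ 0 ⊎ rank v ≡ n → ∃[ u ] u ∈ₛ S × E v u
    neighbour (inj₁ r) = towards 0 1≤n (lower-level {v = v} r) k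
      (upper-level {v = vertex F k} (trans (ofType F k) k≡)) λ v≡k → ℕₚ.0≢1+n (trans (sym r) (trans v≡k k≡))
      where
      k : Fin (suc n)
      k  = Fin.fromℕ< (s≤s 1≤n)
      k≡ = Finₚ.toℕ-fromℕ< (s≤s 1≤n)
    neighbour (inj₂ r) with m , n≡ ← positive 1≤n = below m n≡
      where
      below : ∀ m → n ≡ suc m → ∃[ u ] u ∈ₛ S × E v u
      below m n≡ = towards m m<n (upper-level {v = v} (trans r n≡)) k
        (lower-level {v = vertex F k} (trans (ofType F k) k≡))
        λ v≡k → ℕₚ.1+n≢n (trans (sym n≡) (trans (sym r) (trans v≡k k≡)))
        where
        m<n = ℕₚ.≤-reflexive (sym n≡)
        k : Fin (suc n)
        k  = Fin.fromℕ< (ℕₚ.m<n⇒m<1+n m<n)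
        k≡ = Finₚ.toℕ-fromℕ< (ℕₚ.m<n⇒m<1+n m<n)

  -- A maximal flag through the dense flag (x, y, z), needed because a twin imitates a vertex of a
  -- maximal flag, while an inner extension supplies three vertices only.
  module Glue (a c : MaximalFlag graph) {x y z : Fin size} (xy : Up graph x y) (yz : Up graph y z)
              (ax : vertex a (type x) ≡ x) (cz : vertex c (type z) ≡ z) where

    glue : Fin (suc n) → Fin size
    glue j with ℕₚ.<-cmp (toℕ j) (rank y)
    ... | tri< _ _ _ = vertex a j
    ... | tri≈ _ _ _ = y
    ... | tri> _ _ _ = vertex c j

    glue-x : glue (type x) ≡ x
    glue-x with ℕₚ.<-cmp (rank x) (rank y)
    ... | tri< _ _ _ = ax
    ... | tri≈ _ p _ = contradiction p (near⇒≢ (E-type (proj₁ xy)))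
    ... | tri> _ _ p = contradiction (ℕₚ.≤-trans (ℕₚ.n≤1+n _) (ℕₚ.≤-reflexive (sym (proj₂ xy)))) (ℕₚ.<⇒≱ p)

    glue-z : glue (type z) ≡ z
    glue-z with ℕₚ.<-cmp (rank z) (rank y)
    ... | tri> _ _ _ = cz
    ... | tri≈ _ p _ = contradiction (sym p) (near⇒≢ (E-type (proj₁ yz)))
    ... | tri< p _ _ = contradiction (ℕₚ.≤-trans (ℕₚ.n≤1+n _) (ℕₚ.≤-reflexive (sym (proj₂ yz)))) (ℕₚ.<⇒≱ p)

    glue-all : ∀ {Q : Pred (Fin size) 0ℓ} → Within Q a → Within Q c → Q y → ∀ j → Q (glue j)
    glue-all p q r j with ℕₚ.<-cmp (toℕ j) (rank y)
    ... | tri< _ _ _ = p j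
    ... | tri≈ _ _ _ = r
    ... | tri> _ _ _ = q j

    ranks : ∀ j → rank (glue j) ≡ toℕ j
    ranks j with ℕₚ.<-cmp (toℕ j) (rank y)
    ... | tri< _ _ _ = ofType a j
    ... | tri≈ _ p _ = sym p
    ... | tri> _ _ _ = ofType c j

    edges : ∀ j k → toℕ k ≡ suc (toℕ j) → E (glue j) (glue k)
    edges j k k≡ with ℕₚ.<-cmp (toℕ j) (rank y) | ℕₚ.<-cmp (toℕ k) (rank y)
    ... | tri< _ _ _ | tri< _ _ _ = edge-up a j k k≡
    ... | tri> _ _ _ | tri> _ _ _ = edge-up c j k k≡
    ... | tri< _ _ _ | tri≈ _ p _ = subst (λ u → E u y) (trans (sym ax) (cong (vertex a) (Finₚ.toℕ-injective
            (ℕₚ.suc-injective (trans (sym (proj₂ xy)) (trans (sym p) k≡)))))) (proj₁ xy)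
    ... | tri≈ _ p _ | tri> _ _ _ = subst (E y) (trans (sym cz) (cong (vertex c) (Finₚ.toℕ-injective
            (trans (proj₂ yz) (trans (cong suc (sym p)) (sym k≡)))))) (proj₁ yz)
    ... | tri< p _ _ | tri> _ _ q = contradiction (ℕₚ.≤-trans (ℕₚ.≤-reflexive k≡) p) (ℕₚ.<⇒≱ q)
    ... | tri≈ _ p _ | tri< q _ _ = contradiction (subst₂ _<_ k≡ (sym p) q) (ℕₚ.≤⇒≯ (ℕₚ.n≤1+n _))
    ... | tri≈ _ p _ | tri≈ _ q _ = contradiction (trans (sym k≡) (trans q (sym p))) ℕₚ.1+n≢n
    ... | tri> _ _ p | tri≈ _ q _ = contradiction (ℕₚ.m<n⇒m<1+n p) (ℕₚ.<-irrefl (trans (sym q) k≡))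
    ... | tri> _ _ p | tri< q _ _ = contradiction (ℕₚ.<-trans (subst (_< rank y) k≡ q) p) (ℕₚ.≤⇒≯ (ℕₚ.n≤1+n _))

    flag : MaximalFlag graph
    flag = mkFlag glue ranks edges

  inner-twin : ∀ {F S x y z v} → Built F (_∈ₛ S) → v ∉ₛ S → x ∈ₛ S → y ∈ₛ S → z ∈ₛ S →
               Up graph x y → Up graph y z → type v ≡ type y →
               (∀ {u} → u ∈ₛ S → E v u ⇔ (u ≡ x ⊎ u ≡ z)) → ∃[ g ] Twin (_∈ₛ S) g v
  inner-twin {S = S} {x} {y} {z} {v} b v∉S x∈ y∈ z∈ xy yz v~y nbrs
    with a , wa , ax ← built-flag b x∈ | c , wc , cz ← built-flag b z∈ = flag , record
      { fresh      = v∉S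
      ; within     = glue-all wa wc y∈
      ; neighbours = λ {u} u∈ → mk⇔ (λ vu → there′ (⇒ (nbrs u∈) vu)) (λ q → ⇐ (nbrs u∈) (back q))
      }
    where
    open Glue a c xy yz ax cz

    rv : rank v ≡ rank y
    rv = cong toℕ v~y

    there′ : ∀ {u} → u ≡ x ⊎ u ≡ z → ∃[ j ] Near (rank v) (toℕ j) × glue j ≡ u
    there′ (inj₁ refl) = type x , inj₂ (trans rv (proj₂ xy)) , glue-x
    there′ (inj₂ refl) = type z , inj₁ (trans (proj₂ yz) (cong suc (sym rv))) , glue-z

    back : ∀ {u} → ∃[ j ] Near (rank v) (toℕ j) × glue j ≡ u → u ≡ x ⊎ u ≡ z
    back (j , inj₁ p , refl) with refl ← Finₚ.toℕ-injective {i = j} {type z}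
      (trans p (trans (cong suc rv) (sym (proj₂ yz)))) = inj₂ glue-z
    back (j , inj₂ p , refl) with refl ← Finₚ.toℕ-injective {i = j} {type x}
      (ℕₚ.suc-injective (trans (sym p) (trans rv (proj₂ xy)))) = inj₁ glue-x

  elementary⇒built : ∀ {F S S′} → Elementary B S S′ → Built F (_∈ₛ S) → Built F (_∈ₛ S′)
  elementary⇒built {S = S} (outer {v} _ v∉S extreme unique conn) b =
    add b (proj₂ (outer-twin b v∉S extreme unique conn)) (∈-∪⁅⁆ S v)
  elementary⇒built {S = S} (inner {v = v} _ v∉S x∈ y∈ z∈ xy yz v~y nbrs) b =
    add b (proj₂ (inner-twin b v∉S x∈ y∈ z∈ xy yz v~y nbrs)) (∈-∪⁅⁆ S v)

  strong⇒built : ∀ {F S S′} → Star (Elementary B) S S′ → Built F (_∈ₛ S) → Built F (_∈ₛ S′)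
  strong⇒built ε       b = b
  strong⇒built (e ◅ p) b = strong⇒built p (elementary⇒built e b)

  built⇒extendable : ∀ {F S} → Built F (_∈ₛ S) → Extendable B S
  built⇒extendable {F} b = record
    { connected = built-econnected b
    ; inner     = λ t _ t<n → let t<1+n = ℕₚ.m<n⇒m<1+n t<n in
        vertex F (Fin.fromℕ< t<1+n) , built-within b _ , trans (ofType F _) (Finₚ.toℕ-fromℕ< t<1+n)
    ; nonempty  = vertex F zero , built-within b zero
    }

  outer-elementary : ∀ {F S g v} → Built F (_∈ₛ S) → Twin (_∈ₛ S) g v → rank v ≡ 0 ⊎ rank v ≡ n →
                     Elementary B S (S ∪ ⁅ v ⁆)
  outer-elementary {S = S} {g} {v} b t extreme = outer (built⇒extendable b) fresh extreme
    (λ u∈ w∈ vu vw →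
      let j , nr , p   = ⇒ (neighbours u∈) vu
          k , nr′ , p′ = ⇒ (neighbours w∈) vw
      in trans (sym p) (trans (cong (vertex g) (Finₚ.toℕ-injective
           (near-extreme extreme nr nr′ (ℕₚ.≤-pred (Finₚ.toℕ<n j)) (ℕₚ.≤-pred (Finₚ.toℕ<n k))))) p′))
    (built-econnected (add b t (∈-∪⁅⁆ S v)))
    where open Twin t

  inner-elementary : ∀ {F S g v} → Built F (_∈ₛ S) → Twin (_∈ₛ S) g v →
                     (i k : Fin (suc n)) → rank v ≡ suc (toℕ i) → toℕ k ≡ suc (rank v) →
                     Elementary B S (S ∪ ⁅ v ⁆)
  inner-elementary {g = g} {v} b t i k vi kv =
    inner (built⇒extendable b) fresh (within i) (within (type v)) (within k)
      (edge-up g i (type v) vi , trans (ofType g (type v)) (trans vi (cong suc (sym (ofType g i)))))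
      (edge-up g (type v) k kv , trans (ofType g k) (trans kv (cong suc (sym (ofType g (type v))))))
      (sym (type-vertex g (type v)))
      (λ u∈ → mk⇔ (λ vu → to (⇒ (neighbours u∈) vu)) (λ p → ⇐ (neighbours u∈) (from p)))
    where
    open Twin t

    to : ∀ {u} → ∃[ j ] Near (rank v) (toℕ j) × vertex g j ≡ u → u ≡ vertex g i ⊎ u ≡ vertex g k
    to (j , inj₁ p , refl) = inj₂ (cong (vertex g) (Finₚ.toℕ-injective (trans p (sym kv))))
    to (j , inj₂ p , refl) = inj₁ (cong (vertex g) (Finₚ.toℕ-injective (ℕₚ.suc-injective (trans (sym p) vi))))

    from : ∀ {u} → u ≡ vertex g i ⊎ u ≡ vertex g k → ∃[ j ] Near (rank v) (toℕ j) × vertex g j ≡ u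
    from (inj₁ refl) = i , inj₂ vi , refl
    from (inj₂ refl) = k , inj₁ kv , refl

  twin⇒elementary : ∀ {F S g v} → Built F (_∈ₛ S) → Twin (_∈ₛ S) g v → Elementary B S (S ∪ ⁅ v ⁆)
  twin⇒elementary {v = v} b t with ℕₚ.m≤n⇒m<n∨m≡n (rank≤n v) | ℕₚ.m≤n⇒m<n∨m≡n (z≤n {rank v})
  ... | inj₂ r   | _        = outer-elementary b t (inj₂ r)
  ... | inj₁ _   | inj₂ r   = outer-elementary b t (inj₁ (sym r))
  ... | inj₁ v<n | inj₁ 0<v with m , v≡ ← positive 0<v = inner-elementary b t
          (Fin.fromℕ< m<1+n) (Fin.fromℕ< (s≤s v<n))
          (trans v≡ (cong suc (sym (Finₚ.toℕ-fromℕ< m<1+n)))) (Finₚ.toℕ-fromℕ< (s≤s v<n))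
    where
    m<1+n = ℕₚ.<-trans (ℕₚ.≤-reflexive (sym v≡)) (ℕₚ.m<n⇒m<1+n v<n)

  built⇒strong : ∀ {F Q S₀ S} → Built F Q → (_∈ₛ S₀) ≐ Image F → (_∈ₛ S) ≐ Q → Star (Elementary B) S₀ S
  built⇒strong {S₀ = S₀} (start e) (p , p′) (q , q′) =
    subst (Star (Elementary B) S₀)
      (Subsetₚ.⊆-antisym (q′ ∘ proj₂ e ∘ p) (p′ ∘ proj₁ e ∘ q)) ε
  built⇒strong {F} {S₀ = S₀} {S} (add {Q₀} {g} {v} b t e) s (q , q′) =
    built⇒strong b s S⁻≐Q₀ ◅◅ (twin⇒elementary (built-resp S⁻≐Q₀ b) t⁻ ◅ subst (Star (Elementary B) _) S≡ ε)
    where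
    open Twin t

    -- `Elementary` speaks of subsets, while `Q₀` is only a predicate; removing the fresh `v` from
    -- `S` represents it.
    S⁻? : Decidable (λ u → u ∈ₛ S × u ≢ v)
    S⁻? u = (u Subsetₚ.∈? S) ×-dec ¬? (u Finₚ.≟ v)

    S⁻ : Subset size
    S⁻ = comprehension S⁻?

    S⁻≐Q₀ : (_∈ₛ S⁻) ≐ Q₀
    S⁻≐Q₀ = to , from
      where
      to : (_∈ₛ S⁻) ⊆ Q₀
      to z with u∈S , u≢v ← proj₁ (∈-comprehension S⁻?) z with proj₁ e (q u∈S)
      ... | inj₁ z₀ = z₀
      ... | inj₂ p  = contradiction p u≢v

      from : Q₀ ⊆ (_∈ₛ S⁻)
      from z = proj₂ (∈-comprehension S⁻?) (q′ (proj₂ e (inj₁ z)) , λ { refl → fresh z })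

    t⁻ : Twin (_∈ₛ S⁻) g v
    t⁻ = record
      { fresh      = fresh ∘ proj₁ S⁻≐Q₀
      ; within     = proj₂ S⁻≐Q₀ ∘ within
      ; neighbours = neighbours ∘ proj₁ S⁻≐Q₀
      }

    S≡ : S⁻ ∪ ⁅ v ⁆ ≡ S
    S≡ = Subsetₚ.⊆-antisym
      (λ z → case proj₁ (∈-∪⁅⁆ S⁻ v) z of λ
        { (inj₁ z⁻) → proj₁ (proj₁ (∈-comprehension S⁻?) z⁻)
        ; (inj₂ p)  → q′ (proj₂ e (inj₂ p)) })
      (λ z → proj₂ (∈-∪⁅⁆ S⁻ v) (case proj₁ e (q z) of λ
        { (inj₁ z₀) → inj₁ (proj₂ S⁻≐Q₀ z₀)
        ; (inj₂ p)  → inj₂ p }))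

-- Transport of flags and free constructions along embeddings

module Transport {n : ℕ} {V V′ : Set} {G : LGraph n V} {H : LGraph n V′} (e : Embedding G H) where

  private
    module G = LGraph G
    module H = LGraph H
    module CG = Construction G
    module CH = Construction H
  open Flags using (mkFlag; edge-up)
  open Embedding e
  open Equivalence using () renaming (to to ⇒; from to ⇐)

  rank-pres : ∀ v → H.rank (to v) ≡ G.rank v
  rank-pres v = cong toℕ (type-pres v)

  map-flag : MaximalFlag G → MaximalFlag H
  map-flag x = mkFlag H (to ∘ Flag.vertex x) (λ i → trans (rank-pres _) (Flag.ofType x i))
    λ i j p → ⇒ (E-pres _ _) (edge-up G x i j p)

  comap-flag : (x : MaximalFlag H) (f : ∀ i → ∃[ v ] to v ≡ Flag.vertex x i) → MaximalFlag G
  comap-flag x f = mkFlag G (proj₁ ∘ f)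
    (λ i → trans (sym (rank-pres _)) (trans (cong H.rank (proj₂ (f i))) (Flag.ofType x i)))
    λ i j p → ⇐ (E-pres _ _) (subst₂ H.E (sym (proj₂ (f i))) (sym (proj₂ (f j))) (edge-up H x i j p))

  Direct : Pred V 0ℓ → Pred V′ 0ℓ
  Direct Q w = ∃[ v ] Q v × to v ≡ w

  built-map : ∀ {F Q} → CG.Built F Q → CH.Built (map-flag F) (Direct Q)
  built-map (CG.start (p , p′)) = CH.start
    ( (λ { (v , z , refl) → let j , q = p z in j , cong to q })
    , λ (j , q) → _ , p′ (j , refl) , q)
  built-map (CG.add {Q₀} {g} {v} b t (p , p′)) = CH.add (built-map b) twin
    ( (λ { (u , z , refl) → case p z of λ { (inj₁ z₀) → inj₁ (u , z₀ , refl) ; (inj₂ q) → inj₂ (cong to q) } })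
    , λ { (inj₁ (u , z₀ , q)) → u , p′ (inj₁ z₀) , q ; (inj₂ refl) → v , p′ (inj₂ refl) , refl })
    where
    module T = CG.Twin t

    twin : CH.Twin (Direct Q₀) (map-flag g) (to v)
    twin = record
      { fresh      = λ (u , z , q) → T.fresh (subst Q₀ (injective q) z)
      ; within     = λ i → _ , T.within i , refl
      ; neighbours = λ { (u , z , refl) → mk⇔
          (λ vu → let j , nr , q = ⇒ (T.neighbours z) (⇐ (E-pres _ _) vu)
                  in j , subst (λ r → Near r (toℕ j)) (sym (rank-pres v)) nr , cong to q)
          (λ (j , nr , q) → ⇒ (E-pres _ _)
            (⇐ (T.neighbours z) (j , subst (λ r → Near r (toℕ j)) (rank-pres v) nr , injective q))) }
      }

-- Flags with one vertex multiplied

module _ {n : ℕ} {V : Set} (G : LGraph n V) where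

  open Flags G

  start∈vertices : ∀ {x y} (p : Path G x y) → x ∈ vertices G p
  start∈vertices ε       = here refl
  start∈vertices (_ ◅ _) = here refl

  end∈vertices : ∀ {x y} (p : Path G x y) → y ∈ vertices G p
  end∈vertices ε       = here refl
  end∈vertices (_ ◅ p) = there (end∈vertices p)

  inner-flag : 1 ≤ n → MaximalFlag G → InnerFlag G
  inner-flag (s≤s _) x = record
    { vertex   = vertex x ∘ shift
    ; ofType   = λ i → trans (ofType x (shift i)) (shift≡ i)
    ; distinct = λ {i} {j} p → Finₚ.toℕ-injective (ℕₚ.suc-injective
                   (trans (sym (shift≡ i)) (trans (cong toℕ (Flag.distinct x p)) (shift≡ j))))
    ; incident = λ i j → incident x (shift i) (shift j)
    }
    where
    shift : ∀ {m} → Fin m → Fin (suc (suc m))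
    shift = Fin.inject₁ ∘ suc

    shift≡ : ∀ {m} (i : Fin m) → toℕ (shift i) ≡ suc (toℕ i)
    shift≡ = Finₚ.toℕ-inject₁ ∘ suc

same-level : ∀ {l x y z} → x ≡ l ⊎ x ≡ suc l → y ≡ l ⊎ y ≡ suc l → z ≡ l ⊎ z ≡ suc l →
             Near x y → Near y z → x ≡ z
same-level (inj₁ p) _        (inj₁ q) _ _ = trans p (sym q)
same-level (inj₂ p) _        (inj₂ q) _ _ = trans p (sym q)
same-level (inj₁ p) (inj₁ q) (inj₂ _) a _ = contradiction (trans p (sym q)) (near⇒≢ a)
same-level (inj₁ _) (inj₂ p) (inj₂ q) _ b = contradiction (trans p (sym q)) (near⇒≢ b)
same-level (inj₂ p) (inj₂ q) (inj₁ _) a _ = contradiction (trans p (sym q)) (near⇒≢ a)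
same-level (inj₂ _) (inj₁ p) (inj₁ q) _ b = contradiction (trans p (sym q)) (near⇒≢ b)

-- Only type `i` may have several vertices, and `base` selects one of each type. This covers both
-- graphs to which richness is applied: the plain flag and the flag with one vertex multiplied.
module Layered {n : ℕ} (size : ℕ) (type : Fin size → Fin (suc n)) (base : Fin (suc n) → Fin size)
               (type-base : ∀ j → type (base j) ≡ j) (i : Fin (suc n))
               (single : ∀ v → type v ≢ i → base (type v) ≡ v) where

  layered : FinLGraph n
  layered = record
    { size  = size
    ; graph = record
      { type        = type
      ; E           = λ u v → Near (toℕ (type u)) (toℕ (type v))
      ; E-symmetric = near-sym
      ; E-type      = id
      }
    ; E? = λ u v → (toℕ (type v) ℕₚ.≟ suc (toℕ (type u))) ⊎-dec (toℕ (type u) ℕₚ.≟ suc (toℕ (type v)))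
    }

  open FinLGraph layered using (graph; rank; E)
  open Flags graph
  open Construction graph

  rank-base : ∀ j → rank (base j) ≡ toℕ j
  rank-base j = cong toℕ (type-base j)

  base-flag : MaximalFlag graph
  base-flag = mkFlag base rank-base λ j k p →
    inj₁ (trans (rank-base k) (trans p (cong suc (sym (rank-base j)))))

  unique-of-rank : ∀ {u v} → rank u ≢ toℕ i → rank u ≡ rank v → u ≡ v
  unique-of-rank {u} {v} u≢i p = trans (sym (single u (u≢i ∘ cong toℕ)))
    (trans (cong base (Finₚ.toℕ-injective p)) (single v λ v≡i → u≢i (trans p (cong toℕ v≡i))))

  upward : ∀ d u v → rank v ≡ suc d + rank u → Star (Up graph) u v
  upward zero    u v p = (inj₁ p , p) ◅ ε
  upward (suc d) u v p = (inj₁ w≡ , w≡) ◅ upward d w v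
    (trans p (trans (cong suc (sym (ℕₚ.+-suc d (rank u)))) (cong (suc d +_) (sym w≡))))
    where
    w<n : suc (rank u) < suc n
    w<n = ℕₚ.≤-<-trans (ℕₚ.≤-trans (s≤s (ℕₚ.m≤n+m (rank u) (suc d))) (ℕₚ.≤-reflexive (sym p))) (Finₚ.toℕ<n (type v))

    w : Fin size
    w = base (Fin.fromℕ< w<n)

    w≡ : rank w ≡ suc (rank u)
    w≡ = trans (rank-base _) (Finₚ.toℕ-fromℕ< w<n)

  rank<⇒up : ∀ u v → rank u < rank v → Star (Up graph) u v
  rank<⇒up u v l = upward _ u v (trans (sym (ℕₚ.m∸n+n≡m l)) (ℕₚ.+-suc _ (rank u)))

  rank≢⇒incident : ∀ {u v} → rank u ≢ rank v → Incident graph u v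
  rank≢⇒incident {u} {v} ne with ℕₚ.<-cmp (rank u) (rank v)
  ... | tri< p _ _ = inj₁ (rank<⇒up u v p)
  ... | tri≈ _ p _ = contradiction p ne
  ... | tri> _ _ p = inj₂ (rank<⇒up v u p)

  incident⇒≡ : ∀ {u v} → Incident graph u v → rank u ≡ rank v → u ≡ v
  incident⇒≡ (inj₁ p) e = up-equal p e
  incident⇒≡ (inj₂ p) e = sym (up-equal p (sym e))

  -- A vertex of rank other than `l` is incident with all vertices of rank `l`, so the other vertex
  -- is the meet.
  meet : ∀ l {u v} → u ≢ v → (∃[ z ] MeetIn graph l u v z) ⊎ MeetInEmpty graph l u v
  meet l {u} {v} u≢v with rank u ℕₚ.≟ l | rank v ℕₚ.≟ l
  ... | no u≢l  | _       = inj₁ (v , λ w w≡ → mk⇔ proj₂ (rank≢⇒incident (λ e → u≢l (trans e w≡)) ,_))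
  ... | yes _   | no v≢l  = inj₁ (u , λ w w≡ → mk⇔ proj₁ (_, rank≢⇒incident (λ e → v≢l (trans e w≡))))
  ... | yes u≡l | yes v≡l = inj₂ λ w w≡ (p , q) →
          u≢v (trans (incident⇒≡ p (trans u≡l (sym w≡))) (sym (incident⇒≡ q (trans v≡l (sym w≡)))))

  -- If b and b′ have the same rank, this is rank i, so a is the only vertex of its rank and the cycle
  -- leaves b away from it.
  detour : ∀ {a b b′} (γ : SimpleCycle graph a b b′) → rank b ≡ rank b′ →
           ∃[ d ] d ∈ vertices graph (SimpleCycle.path γ) × E b d × rank d ≢ rank a
                  × 1 ≤ pathLength graph (SimpleCycle.path γ)
  detour {a} {b} {b′} γ rb with SimpleCycle.path γ | SimpleCycle.distinct γ
  ... | ε               | _              = contradiction refl (SimpleCycle.b≢b′ γ)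
  ... | _◅_ {j = d} e p | (_ ∷ a≢) ∷ _ = d , there (start∈vertices graph p) , e , rd , s≤s z≤n
    where
    ra : rank a ≢ toℕ i
    ra a≡i with rank b ℕₚ.≟ toℕ i
    ... | yes b≡i = near⇒≢ (SimpleCycle.first γ) (trans a≡i (sym b≡i))
    ... | no b≢i  = SimpleCycle.b≢b′ γ (unique-of-rank b≢i rb)

    rd : rank d ≢ rank a
    rd p≡ = All.lookup a≢ (start∈vertices graph p) (unique-of-rank ra (sym p≡))

  layered-econnected : ∀ {P} → (∀ j → ∃[ v ] P v × type v ≡ j) → EConnected graph P
  layered-econnected {P} rep l l<n = star⇒connected joined
    where
    l<1+n  = ℕₚ.m<n⇒m<1+n l<n
    lower  = rep (Fin.fromℕ< l<1+n)
    upper  = rep (Fin.fromℕ< (s≤s l<n))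
    p = proj₁ lower
    q = proj₁ upper
    p≡ = trans (cong toℕ (proj₂ (proj₂ lower))) (Finₚ.toℕ-fromℕ< l<1+n)
    q≡ = trans (cong toℕ (proj₂ (proj₂ upper))) (Finₚ.toℕ-fromℕ< (s≤s l<n))
    pl = proj₁ (proj₂ lower) , lower-level {v = p} p≡
    ql = proj₁ (proj₂ upper) , upper-level {v = q} q≡

    joined : ∀ {u} → Level P l u → Joined (Level P l) u p
    joined {u} (z , lv) with level-rank {l} {u} lv
    ... | inj₂ r = joined-edge {Level P l} (z , lv) pl (inj₂ (trans r (cong suc (sym p≡))))
    ... | inj₁ r = (((z , lv) , ql , inj₁ (trans q≡ (cong suc (sym r))))) ◅
                   joined-edge {Level P l} ql pl (inj₂ (trans q≡ (cong suc (sym p≡))))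

  layered∈K : InK layered
  layered∈K = record
    { noECycles = noECycles
    ; intersect = meet 0
    ; generate  = meet n
    ; descend   = descend
    ; ascend    = ascend
    }
    where
    open SimpleCycle

    -- Within two levels ranks alternate along the cycle, so the vertex after `b` would have the
    -- rank of `a`, which `detour` rules out.
    noECycles : ∀ l → l < n → ∀ {a b b′} (γ : SimpleCycle graph a b b′) →
      ¬ All (InLevels graph l (suc l)) (cycleVertices γ)
    noECycles l _ {a} {b} {b′} γ (la ∷ ls) =
      let rank-of = λ {v} (v∈ : v ∈ vertices graph (path γ)) → level-rank {l} {v} (All.lookup ls v∈)
          ra = level-rank {l} {a} la
          rb = rank-of (start∈vertices graph (path γ))
          d , d∈ , bd , rd , _ = detour γ
            (same-level rb ra (rank-of (end∈vertices graph (path γ))) (near-sym (first γ)) (near-sym (last γ)))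
      in rd (sym (same-level ra rb (rank-of d∈) (first γ) bd))

    descend : ∀ {a b b′} (γ : SimpleCycle graph a b b′) h l → h < l →
      rank a ≡ suc l → rank b ≡ l → rank b′ ≡ l →
      All (InLevels graph h (suc l)) (cycleVertices γ) →
      Σ (Path graph b b′) λ p →
        pathLength graph p ≤ suc (pathLength graph (path γ)) ×
        All (λ v → Residue graph a v × InLevels graph h l v × (rank v ≡ h → v ∈ cycleVertices γ))
            (vertices graph p)
    -- The path (b, d, b′) works, with `d` the vertex after `b` on the cycle: its rank is not that
    -- of `a`, so `d` lies on the far side of `b`, and all three vertices occur in the cycle.
    descend {a} {b} {b′} γ h l h<l ra rb rb′ _ with detour γ (trans rb (sym rb′))
    ... | d , d∈ , bd , d≢a , len = bd ◅ db′ ◅ ε , s≤s len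
          , at-l rb (start∈vertices graph (path γ))
          ∷ (rank≢⇒incident (d≢a ∘ sym)
            , (ℕₚ.≤-pred (subst (h <_) (sym rd) h<l) , ℕₚ.≤-trans (ℕₚ.n≤1+n _) (ℕₚ.≤-reflexive rd))
            , λ _ → there d∈)
          ∷ at-l rb′ (end∈vertices graph (path γ)) ∷ []
      where
      rd : suc (rank d) ≡ l
      rd = case bd of λ
        { (inj₁ p) → contradiction (trans p (trans (cong suc rb) (sym ra))) d≢a
        ; (inj₂ p) → trans (sym p) rb }

      db′ : E d b′
      db′ = inj₁ (trans rb′ (sym rd))

      at-l : ∀ {v} → rank v ≡ l → v ∈ vertices graph (path γ) →
             Residue graph a v × InLevels graph h l v × (rank v ≡ h → v ∈ cycleVertices γ)
      at-l rv v∈ = rank≢⇒incident (λ e → ℕₚ.1+n≢n (trans (sym ra) (trans e rv)))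
        , (ℕₚ.≤-trans (ℕₚ.<⇒≤ h<l) (ℕₚ.≤-reflexive (sym rv)) , ℕₚ.≤-reflexive rv) , λ _ → there v∈

    ascend : ∀ {a b b′} (γ : SimpleCycle graph a b b′) h l → 2 + l ≤ h → h ≤ n →
      rank a ≡ l → rank b ≡ suc l → rank b′ ≡ suc l →
      All (InLevels graph l h) (cycleVertices γ) →
      Σ (Path graph b b′) λ p →
        pathLength graph p ≤ suc (pathLength graph (path γ)) ×
        All (λ v → Residue graph a v × InLevels graph (suc l) h v × (rank v ≡ h → v ∈ cycleVertices γ))
            (vertices graph p)
    ascend {a} {b} {b′} γ h l l<h _ ra rb rb′ _ with detour γ (trans rb (sym rb′))
    ... | d , d∈ , bd , d≢a , len = bd ◅ db′ ◅ ε , s≤s len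
          , at-l rb (start∈vertices graph (path γ))
          ∷ (rank≢⇒incident (d≢a ∘ sym)
            , (ℕₚ.≤-trans (ℕₚ.n≤1+n _) (ℕₚ.≤-reflexive (sym rd)) , ℕₚ.≤-trans (ℕₚ.≤-reflexive rd) l<h)
            , λ _ → there d∈)
          ∷ at-l rb′ (end∈vertices graph (path γ)) ∷ []
      where
      rd : rank d ≡ suc (suc l)
      rd = case bd of λ
        { (inj₁ p) → trans p (cong suc rb)
        ; (inj₂ p) → contradiction (ℕₚ.suc-injective (trans (sym p) (trans rb (cong suc (sym ra))))) d≢a }

      db′ : E d b′
      db′ = inj₂ (trans rd (cong suc (sym rb′)))

      at-l : ∀ {v} → rank v ≡ suc l → v ∈ vertices graph (path γ) →
             Residue graph a v × InLevels graph (suc l) h v × (rank v ≡ h → v ∈ cycleVertices γ)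
      at-l rv v∈ = rank≢⇒incident (λ e → ℕₚ.1+n≢n (trans (sym rv) (trans (sym e) ra)))
        , (ℕₚ.≤-reflexive (sym rv) , ℕₚ.≤-trans (ℕₚ.≤-reflexive rv) (ℕₚ.<⇒≤ l<h)) , λ _ → there v∈

  layered∈K′ : InK′ layered
  layered∈K′ = record
    { inK              = layered∈K
    ; connected        = layered-econnected λ j → base j , _ , type-base j
    ; residueConnected = λ a → layered-econnected (rep a)
    }
    where
    rep : ∀ a j → ∃[ v ] Residue graph a v × type v ≡ j
    rep a j with type a Finₚ.≟ j
    ... | yes p = a , inj₁ ε , p
    ... | no ne = base j , rank≢⇒incident (λ e → ne (Finₚ.toℕ-injective (trans e (rank-base j)))) , type-base j

  layered-built : Built base-flag U
  layered-built = built-resp ((λ {v} _ → inj₂ (Finₚ.toℕ<n v)) , _) (upto size ℕₚ.≤-refl)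
    where
    -- The base flag is present from the start; the scan through the indices adds only vertices
    -- outside it.
    Upto : ℕ → Pred (Fin size) 0ℓ
    Upto m v = Image base-flag v ⊎ toℕ v < m

    upto : ∀ m → m ≤ size → Built base-flag (Upto m)
    upto zero    _  = start ((λ { (inj₁ p) → p }) , inj₁)
    upto (suc m) lt = extend (v Finₚ.≟ base (type v))
      where
      v : Fin size
      v = Fin.fromℕ< lt

      v≡ : toℕ v ≡ m
      v≡ = Finₚ.toℕ-fromℕ< lt

      split : ∀ {u} → Upto (suc m) u → Upto m u ⊎ u ≡ v
      split (inj₁ p) = inj₁ (inj₁ p)
      split (inj₂ (s≤s p)) with ℕₚ.m≤n⇒m<n∨m≡n p
      ... | inj₁ l = inj₁ (inj₂ l)
      ... | inj₂ e = inj₂ (Finₚ.toℕ-injective (trans e (sym v≡)))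

      weaken : ∀ {u} → Upto m u → Upto (suc m) u
      weaken (inj₁ p) = inj₁ p
      weaken (inj₂ p) = inj₂ (ℕₚ.m<n⇒m<1+n p)

      extend : Dec (v ≡ base (type v)) → Built base-flag (Upto (suc m))
      extend (yes p) = built-resp
        ((λ z → case split z of λ { (inj₁ y) → y ; (inj₂ refl) → inj₁ (type v , sym p) }) , weaken)
        (upto m (ℕₚ.<⇒≤ lt))
      extend (no ne) = add (upto m (ℕₚ.<⇒≤ lt)) twin
        (split , λ { (inj₁ z) → weaken z ; (inj₂ refl) → inj₂ (s≤s (ℕₚ.≤-reflexive v≡)) })
        where
        v~i : type v ≡ i
        v~i with type v Finₚ.≟ i
        ... | yes p = p
        ... | no p  = contradiction (sym (single v p)) ne

        twin : Twin (Upto m) base-flag v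
        twin = record
          { fresh      = λ { (inj₁ (j , p)) → ne (trans (sym p) (cong base (trans (sym (type-base j)) (cong type p))))
                           ; (inj₂ l)       → ℕₚ.<-irrefl v≡ l }
          ; within     = λ j → inj₁ (j , refl)
          ; neighbours = λ {u} _ → mk⇔
              (λ nr → type u , nr , single u λ u~i → near⇒≢ nr (cong toℕ (trans v~i (sym u~i))))
              (λ { (j , nr , refl) → subst (Near (rank v)) (sym (rank-base j)) nr })
          }

module FlagGraph (n : ℕ) = Layered {n} (suc n) id id (λ _ → refl) zero (λ _ _ → refl)

flag-embedding : ∀ {n V} (H : LGraph n V) → MaximalFlag H →
                 Embedding (FinLGraph.graph (FlagGraph.layered n)) H
flag-embedding H x = record
  { to        = vertex x
  ; injective = Flag.distinct x
  ; type-pres = type-vertex x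
  ; E-pres    = λ i j → mk⇔ (edge x i j) λ e → subst₂ Near (ofType x i) (ofType x j) (E-type e)
  }
  where
  open Flags H
  open LGraph H

module Multiplied (n : ℕ) (i : Fin (suc n)) (k : ℕ) where

  type : Fin (suc n + k) → Fin (suc n)
  type v = [ id , const i ]′ (Fin.splitAt (suc n) v)

  copy : Fin k → Fin (suc n + k)
  copy = suc n Fin.↑ʳ_

  type-base : ∀ j → type (j Fin.↑ˡ k) ≡ j
  type-base j = cong [ id , const i ]′ (Finₚ.splitAt-↑ˡ (suc n) j k)

  type-copy : ∀ c → type (copy c) ≡ i
  type-copy c = cong [ id , const i ]′ (Finₚ.splitAt-↑ʳ (suc n) k c)

  single : ∀ v → type v ≢ i → type v Fin.↑ˡ k ≡ v
  single v ne with Fin.splitAt (suc n) v in eq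
  ... | inj₁ j = Finₚ.splitAt⁻¹-↑ˡ eq
  ... | inj₂ c = contradiction refl ne

  open Layered (suc n + k) type (Fin._↑ˡ k) type-base i single public

-- Countably infinite setoids

-- Cantor's enumeration of pairs: each antidiagonal is run through from (s, 0) to (0, s).
unpair : ℕ → ℕ × ℕ
unpair zero    = 0 , 0
unpair (suc k) with unpair k
... | zero  , b = suc b , zero
... | suc a , b = a , suc b

unpair-along : ∀ b {a c} k → unpair k ≡ (b + a , c) → unpair (b + k) ≡ (a , b + c)
unpair-along zero    k p = p
unpair-along (suc b) {a} {c} k p =
  subst₂ (λ l r → unpair l ≡ (a , r)) (ℕₚ.+-suc b k) (ℕₚ.+-suc b c) (unpair-along b (suc k) next)
  where
  next : unpair (suc k) ≡ (b + a , suc c)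
  next rewrite p = refl

unpair-diagonal : ∀ s → ∃[ k ] unpair k ≡ (s , 0)
unpair-diagonal zero    = 0 , refl
unpair-diagonal (suc s) with k , p ← unpair-diagonal s = suc (s + k) , next
  where
  next : unpair (suc (s + k)) ≡ (suc s , 0)
  next rewrite unpair-along s {0} {0} k (trans p (cong (_, 0) (sym (ℕₚ.+-identityʳ s))))
             | ℕₚ.+-identityʳ s = refl

unpair-surjective : ∀ a b → ∃[ k ] unpair k ≡ (a , b)
unpair-surjective a b with k , p ← unpair-diagonal (b + a) =
  b + k , trans (unpair-along b k p) (cong (a ,_) (ℕₚ.+-identityʳ b))

-- `large` asks for finite families of every size instead of an injection from ℕ, because richness
-- gives no coherent sequence. The bijection lists the first occurrences in `enum`.
module Countable {A : Set} {_≈_ : Rel A 0ℓ} (isEquivalence : IsEquivalence _≈_)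
  (_≟_ : ∀ x y → Dec (x ≈ y)) (enum : ℕ → A) (enum-surjective : ∀ x → ∃[ k ] enum k ≈ x)
  (large : ∀ k → Σ (Fin k → A) λ f → ∀ {i j} → f i ≈ f j → i ≡ j) where

  private module X = IsEquivalence isEquivalence

  Seen : ℕ → Pred A 0ℓ
  Seen m x = ∃[ j ] j < m × enum j ≈ x

  seen? : ∀ m → Decidable (Seen m)
  seen? m x = ℕₚ.anyUpTo? (λ j → enum j ≟ x) m

  New : Pred ℕ 0ℓ
  New k = ¬ Seen k (enum k)

  new? : Decidable New
  new? k = ¬? (seen? k (enum k))

  first : ∀ x → ∃[ k ] New k × enum k ≈ x
  first x = let k , p = enum-surjective x in <-rec P search k p
    where
    P : ℕ → Set
    P k = enum k ≈ x → ∃[ j ] New j × enum j ≈ x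

    search : ∀ k → (∀ {j} → j < k → P j) → P k
    search k rec p with seen? k (enum k)
    ... | no new          = k , new , p
    ... | yes (j , l , q) = rec l (X.trans q p)

  unseen : ∀ m → ∃[ x ] ¬ Seen m x
  unseen m with f , inj ← large (suc m) with Finₚ.any? (λ i → ¬? (seen? m (f i)))
  ... | yes (i , p) = f i , p
  ... | no all-seen =
    let i , j , i<j , p = Finₚ.pigeonhole ℕₚ.≤-refl index
    in contradiction (cong toℕ (inj (X.trans (X.sym (index≈ i))
         (X.trans (X.reflexive (cong (enum ∘ toℕ) p)) (index≈ j))))) (ℕₚ.<⇒≢ i<j)
    where
    found : ∀ i → Seen m (f i)
    found i = decidable-stable (seen? m (f i)) λ ¬p → all-seen (i , ¬p)

    index : Fin (suc m) → Fin m
    index i = Fin.fromℕ< (proj₁ (proj₂ (found i)))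

    index≈ : ∀ i → enum (toℕ (index i)) ≈ f i
    index≈ i = X.trans (X.reflexive (cong enum (Finₚ.toℕ-fromℕ< _))) (proj₂ (proj₂ (found i)))

  LeastNew : ℕ → ℕ → Set
  LeastNew m k = m ≤ k × New k × (∀ {j} → New j → m ≤ j → k ≤ j)

  least : ∀ d m → New (d + m) → ∃ (LeastNew m)
  least d m new with new? m
  ... | yes p = m , ℕₚ.≤-refl , p , λ _ l → l
  least zero    m new | no ¬p = contradiction new ¬p
  least (suc d) m new | no ¬p =
    let k , m<k , newk , min = least d (suc m) (subst New (sym (ℕₚ.+-suc d m)) new)
    in k , ℕₚ.<⇒≤ m<k , newk , λ newj m≤j →
         min newj (ℕₚ.≤∧≢⇒< m≤j λ { refl → ¬p newj })

  abstract
    next-new : ∀ m → ∃ (LeastNew m)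
    next-new m with x , ¬seen ← unseen m with k , new , p ← first x =
      least (k ∸ m) m (subst New (sym (ℕₚ.m∸n+n≡m (ℕₚ.≮⇒≥ λ k<m → ¬seen (k , k<m , p)))) new)

  nth : ℕ → ℕ
  nth zero    = proj₁ (next-new 0)
  nth (suc m) = proj₁ (next-new (suc (nth m)))

  nth-new : ∀ m → New (nth m)
  nth-new zero    = proj₁ (proj₂ (proj₂ (next-new 0)))
  nth-new (suc m) = proj₁ (proj₂ (proj₂ (next-new (suc (nth m)))))

  nth-suc : ∀ m → nth m < nth (suc m)
  nth-suc m = proj₁ (proj₂ (next-new (suc (nth m))))

  nth-mono : ∀ {m k} → m < k → nth m < nth k
  nth-mono {m} {suc k} (s≤s m≤k) with ℕₚ.m≤n⇒m<n∨m≡n m≤k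
  ... | inj₁ l    = ℕₚ.<-trans (nth-mono l) (nth-suc k)
  ... | inj₂ refl = nth-suc k

  nth-≥ : ∀ m → m ≤ nth m
  nth-≥ zero    = z≤n
  nth-≥ (suc m) = ℕₚ.≤-<-trans (nth-≥ m) (nth-suc m)

  -- By minimality of each choice, a new index never hit would exceed every `nth m`, against
  -- `m ≤ nth m`.
  nth-covers : ∀ {k} → New k → ∃[ m ] nth m ≡ k
  nth-covers {k} new with reach k
    where
    reach : ∀ m → (∃[ m′ ] nth m′ ≡ k) ⊎ nth m < k
    reach zero with ℕₚ.m≤n⇒m<n∨m≡n (proj₂ (proj₂ (proj₂ (next-new 0))) new z≤n)
    ... | inj₁ l = inj₂ l
    ... | inj₂ e = inj₁ (0 , e)
    reach (suc m) with reach m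
    ... | inj₁ p = inj₁ p
    ... | inj₂ l with ℕₚ.m≤n⇒m<n∨m≡n (proj₂ (proj₂ (proj₂ (next-new (suc (nth m))))) new l)
    ...   | inj₁ l′ = inj₂ l′
    ...   | inj₂ e  = inj₁ (suc m , e)
  ... | inj₁ p = p
  ... | inj₂ l = contradiction (nth-≥ k) (ℕₚ.<⇒≱ l)

  nth-distinct : ∀ {m k} → m < k → ¬ enum (nth m) ≈ enum (nth k)
  nth-distinct {m} {k} l p = nth-new k (nth m , nth-mono l , p)

  ℕ↔A : Inverse (setoid ℕ) record { isEquivalence = isEquivalence }
  ℕ↔A = Bijection⇒Inverse record
    { to        = enum ∘ nth
    ; cong      = λ { refl → X.refl }
    ; bijective = injective , λ x →
        let k , new , p = first x
            m , q       = nth-covers new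
        in m , λ { refl → X.trans (X.reflexive (cong enum q)) p }
    }
    where
    injective : ∀ {m k} → enum (nth m) ≈ enum (nth k) → m ≡ k
    injective {m} {k} p with ℕₚ.<-cmp m k
    ... | tri< l _ _ = contradiction p (nth-distinct l)
    ... | tri≈ _ e _ = e
    ... | tri> _ _ l = contradiction (X.sym p) (nth-distinct l)

-- The building

built⇒Strong : ∀ {n} (1≤n : 1 ≤ n) (B : FinLGraph n) (x : MaximalFlag (FinLGraph.graph B)) →
               Construction.Built (FinLGraph.graph B) x U →
               Strong {A = FlagGraph.layered n} {B = B} (flag-embedding (FinLGraph.graph B) x)
built⇒Strong 1≤n B x b =
  comprehension image?
  , (λ v → mk⇔ (proj₁ (∈-comprehension image?)) (proj₂ (∈-comprehension image?)))
  , StrongExtension.built⇒strong 1≤n B b (∈-comprehension image?) (_ , λ _ → Subsetₚ.∈⊤)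
  where
  image? : Decidable (Construction.Image (FinLGraph.graph B) x)
  image? v = Finₚ.any? λ i → Flag.vertex x i Finₚ.≟ v

module Limit {n : ℕ} (1≤n : 1 ≤ n) {V : Set} (M : LGraph n V) (H : HrushovskiLimit M) where

  open HrushovskiLimit H
  open FinLGraph using (size; graph)
  open Embedding using (to; injective; type-pres; E-pres)
  open LGraph M
  open Flags M
  open Construction M
  open Words {n}
  open Equivalence using () renaming (to to ⇒; from to ⇐)

  Stage : ℕ → Pred V 0ℓ
  Stage j v = ∃[ a ] to (ι j) a ≡ v

  stage-+ : ∀ d {j} → Stage j ⊆ Stage (d + j)
  stage-+ zero    p = p
  stage-+ (suc d) p with a , refl ← stage-+ d p = _ , ι-compatible _ a

  stage-mono : ∀ {i j} → i ≤ j → Stage i ⊆ Stage j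
  stage-mono {i} l p = subst (λ j → Stage j _) (ℕₚ.m∸n+n≡m l) (stage-+ _ p)

  common-stage : ∀ {m} (f : Fin m → V) → ∃[ j ] ∀ k → Stage j (f k)
  common-stage {zero}  f = 0 , λ ()
  common-stage {suc m} f =
    let i , p = ι-covers (f zero)
        j , q = common-stage (f ∘ suc)
    in i ⊔ j , λ { zero → stage-mono (ℕₚ.m≤m⊔n i j) p ; (suc k) → stage-mono (ℕₚ.m≤n⊔m i j) (q k) }

  common-stage₂ : ∀ u v → ∃[ j ] Stage j u × Stage j v
  common-stage₂ u v =
    let i , p = ι-covers u
        j , q = ι-covers v
    in i ⊔ j , stage-mono (ℕₚ.m≤m⊔n i j) p , stage-mono (ℕₚ.m≤n⊔m i j) q

  _≟_ : DecidableEquality V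
  u ≟ v with common-stage₂ u v
  ... | j , (a , refl) , (b , refl) = map′ (cong (to (ι j))) (injective (ι j)) (a Finₚ.≟ b)

  E? : ∀ u v → Dec (E u v)
  E? u v with common-stage₂ u v
  ... | j , (a , refl) , (b , refl) =
    map′ (⇒ (E-pres (ι j) a b)) (⇐ (E-pres (ι j) a b)) (FinLGraph.E? (stage j) a b)

  F : ∀ j → MaximalFlag (graph (stage j))
  F zero    = proj₁ stage₀-flag
  F (suc j) = Transport.map-flag (next j) (F j)

  stage-built : ∀ j → Construction.Built (graph (stage j)) (F j) U
  stage-built zero    = Construction.start ((λ {v} _ → proj₂ stage₀-flag v) , _)
  stage-built (suc j) with S , S⇔ , p ← next-strong j =
    Construction.built-resp _ ((λ _ → Subsetₚ.∈⊤) , _)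
      (StrongExtension.strong⇒built 1≤n (stage (suc j)) p
        (Construction.built-resp _
          ((λ {v} v∈ → let a , e = ⇒ (S⇔ v) v∈ in a , _ , e) , λ {v} (a , _ , e) → ⇐ (S⇔ v) (a , e))
          (Transport.built-map (next j) (stage-built j))))

  stage-built-in-M : ∀ j → Built (Transport.map-flag (ι j) (F j)) (Stage j)
  stage-built-in-M j = built-resp ((λ (a , e) → a , _ , e) , λ (a , _ , e) → a , e)
    (Transport.built-map (ι j) (stage-built j))

  flag-stage : ∀ x → ∃[ j ] Within (Stage j) x
  flag-stage x = common-stage (vertex x)

  gallery-stage : ∀ {w x y} → Gal U w x y → ∃[ j ] Gal (Stage j) w x y
  gallery-stage {x = x} (done _ e) = let j , q = flag-stage x in j , done q e
  gallery-stage {x = x} (step _ a γ) =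
    let i , q = flag-stage x
        j , δ = gallery-stage γ
    in i ⊔ j , step (stage-mono (ℕₚ.m≤m⊔n i j) ∘ q) a (gal-mono (stage-mono (ℕₚ.m≤n⊔m i j)) δ)

  open DecEq _≟_ using (built-rigid; built-gallery)

  rigid : Rigid _≟_ U
  rigid r e γ = let j , δ = gallery-stage γ in built-rigid (stage-built-in-M j) r e δ

  abstract
    -- Kept `abstract`: `δ` is used only through irreducibility and the existence of the gallery,
    -- whichever one was chosen.
    gallery : ∀ x y → ∃[ w ] Irreducible w × Gal U w x y
    gallery x y =
      let i , p = flag-stage x
          j , q = flag-stage y
          _ , γ = built-gallery (stage-built-in-M (i ⊔ j)) x y
                    (stage-mono (ℕₚ.m≤m⊔n i j) ∘ p) (stage-mono (ℕₚ.m≤n⊔m i j) ∘ q)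
      in gal-irreducible _≟_ (gal-mono _ γ)

  δ : MaximalFlag M → MaximalFlag M → Word n
  δ x y = proj₁ (gallery x y)

  δ-irreducible : ∀ x y → Irreducible (δ x y)
  δ-irreducible x y = proj₁ (proj₂ (gallery x y))

  δ-gallery : ∀ x y → Gal U (δ x y) x y
  δ-gallery x y = proj₂ (proj₂ (gallery x y))

  δ⇒gal : ∀ {w x y} → Irreducible w → δ x y ≈W w → Gal U w x y
  δ⇒gal {x = x} {y} r e = gal-~ (irreducible-≈W⇒~ (δ-irreducible x y) r e) (δ-gallery x y)

  gal⇒δ : ∀ {w x y} → Irreducible w → Gal U w x y → δ x y ≈W w
  gal⇒δ {x = x} {y} r γ = ~⇒≈W (gal-unique _≟_ rigid (δ-irreducible x y) r (δ-gallery x y) γ)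

  irr-letter : ∀ i → Irreducible [ i ]
  irr-letter i = (λ ()) ∷ []

  δ⇒≋ : ∀ {x y} → δ x y ≈W [] → x ≋ y
  δ⇒≋ e with done _ p ← δ⇒gal [] e = p

  ≋⇒δ : ∀ {x y} → x ≋ y → δ x y ≈W []
  ≋⇒δ p = gal⇒δ [] (done _ p)

  δ⇒adj : ∀ {i x y} → δ x y ≈W [ i ] → Adj i x y
  δ⇒adj {i} e with step _ a (done _ p) ← δ⇒gal (irr-letter i) e = adj-cong ≋-refl p a

  adj⇒δ : ∀ {i x y} → Adj i x y → δ x y ≈W [ i ]
  adj⇒δ {i} a = gal⇒δ (irr-letter i) (step _ a (done _ ≋-refl))

  Δ : Setoid 0ℓ 0ℓ
  Δ = maximalFlags M

  -- Stated for an arbitrary `δ′`, since the two notions of gallery are compared both for `δ` and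
  -- for a competing distance.
  Generates : (MaximalFlag M → MaximalFlag M → Word n) → Set
  Generates δ′ = ∀ i x y → δ′ x y ≈W [ i ] ⇔ DifferExactlyAt M i x y

  δ-generates : Generates δ
  δ-generates i x y = mk⇔ (λ e → let mkAdj p q = δ⇒adj e in p , q) λ (p , q) → adj⇒δ (mkAdj p q)

  gallery⇒gal : ∀ {δ′} → Generates δ′ → ∀ {w x y} → Gallery Δ δ′ w x y → Gal U w x y
  gallery⇒gal g (done p)     = done _ (mk≋ p)
  gallery⇒gal g (step _ e γ) = let p , q = ⇒ (g _ _ _) e in step _ (mkAdj p q) (gallery⇒gal g γ)

  gal⇒gallery : ∀ {δ′} → Generates δ′ → ∀ {w x y} → Gal U w x y → Gallery Δ δ′ w x y
  gal⇒gallery g (done _ (mk≋ p))           = done p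
  gal⇒gallery g (step {s} _ (mkAdj p q) γ) = step (λ e → p (e s)) (⇐ (g _ _ _) (p , q)) (gal⇒gallery g γ)

  galleries : GalleryAxiom Δ δ
  galleries red x y = mk⇔
    (λ e → gal⇒gallery δ-generates (δ⇒gal (reduced⇒irreducible red) e))
    (λ γ → gal⇒δ (reduced⇒irreducible red) (gallery⇒gal δ-generates γ))

  flagDistance : IsFlagDistance M δ
  flagDistance = record
    { diagonal   = λ x → ≋⇒δ ≋-refl
    ; generators = δ-generates
    ; reduced    = galleries
    }

  -- `δ x y` is reduced and is the type of a gallery from `x` to `y`, so the gallery clause for `δ′`
  -- forces its value.
  distance-unique : ∀ δ′ → IsFlagDistance M δ′ → ∀ x y → δ′ x y ≈W δ x y
  distance-unique δ′ d x y = ⇐ (D.reduced (irreducible⇒reduced (δ-irreducible x y)) x y)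
    (gal⇒gallery D.generators (δ-gallery x y))
    where module D = IsFlagDistance d

  adjacent⇒ : ∀ {s x y} → Adjacent Δ δ s x y → x ≋ y ⊎ Adj s x y
  adjacent⇒ (inj₁ e) = inj₁ (δ⇒≋ e)
  adjacent⇒ (inj₂ e) = inj₂ (δ⇒adj e)

  ⇒adjacent : ∀ {s x y} → x ≋ y ⊎ Adj s x y → Adjacent Δ δ s x y
  ⇒adjacent (inj₁ p) = inj₁ (≋⇒δ p)
  ⇒adjacent (inj₂ a) = inj₂ (adj⇒δ a)

  agree-off : ∀ {s x y} → Adjacent Δ δ s x y → ∀ j → j ≢ s → vertex x j ≡ vertex y j
  agree-off a j j≢s with adjacent⇒ a
  ... | inj₁ (mk≋ p)     = p j
  ... | inj₂ (mkAdj _ q) = q j j≢s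

  ⇒adjacent-off : ∀ {s x y} → (∀ j → j ≢ s → vertex x j ≡ vertex y j) → Adjacent Δ δ s x y
  ⇒adjacent-off {s} {x} {y} q with vertex x s ≟ vertex y s
  ... | yes p = ⇒adjacent (inj₁ (agree-off⇒≋ p q))
  ... | no p  = ⇒adjacent (inj₂ (mkAdj p q))

  abstract
    embed-multiplied : ∀ (x : MaximalFlag M) (i : Fin (suc n)) k →
      ∃[ j ] Σ (Embedding (graph (Multiplied.layered n i k)) (graph (stage j))) λ g →
        ∀ l → to (ι j) (to g (l Fin.↑ˡ k)) ≡ vertex x l
    embed-multiplied x i k with j , q ← flag-stage x = embed j q
      where
      module C = Multiplied n i k

      embed : ∀ j → Within (Stage j) x → ∃[ j′ ] Σ (Embedding (graph C.layered) (graph (stage j′))) λ g →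
              ∀ l → to (ι j′) (to g (l Fin.↑ˡ k)) ≡ vertex x l
      embed j q =
        let j′ , _ , g , comm , _ = rich {FlagGraph.layered n} {C.layered} (FlagGraph.layered∈K′ n) zero
              (inner-flag _ 1≤n (FlagGraph.base-flag n)) C.layered∈K′
              j (flag-embedding (graph (stage j)) xⱼ) xⱼ-strong
              (flag-embedding (graph C.layered) C.base-flag)
              (built⇒Strong 1≤n C.layered C.base-flag C.layered-built)
        in j′ , g , λ l → trans (comm l) (proj₂ (q l))
        where
        xⱼ : MaximalFlag (graph (stage j))
        xⱼ = Transport.comap-flag (ι j) x q

        xⱼ-strong : Strong {A = FlagGraph.layered n} {B = stage j} (flag-embedding (graph (stage j)) xⱼ)
        xⱼ-strong = built⇒Strong 1≤n (stage j) xⱼ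
          (Construction.DecEq.built-from (graph (stage j)) Finₚ._≟_ (stage-built j) xⱼ _)

    -- `extends` identifies the base flag of the multiplied graph with `x`, so each copy can replace
    -- the `i`-th vertex of `x`.
    copies : ∀ (x : MaximalFlag M) (i : Fin (suc n)) k → Σ (Fin k → V) λ f →
      (∀ {c d} → f c ≡ f d → c ≡ d) × (∀ c → rank (f c) ≡ toℕ i) ×
      (∀ c j → Near (toℕ i) (toℕ j) → E (f c) (vertex x j))
    copies x i k with j , g , extends ← embed-multiplied x i k =
      to (ι j) ∘ to g ∘ C.copy
      , (λ {c} {d} e → Finₚ.↑ʳ-injective (suc n) c d (injective g (injective (ι j) e)))
      , (λ c → cong toℕ (trans (type-pres (ι j) (to g (C.copy c))) (trans (type-pres g (C.copy c)) (C.type-copy c))))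
      , λ c l nr → subst (E (to (ι j) (to g (C.copy c)))) (extends l)
          (⇒ (E-pres (ι j) (to g (C.copy c)) (to g (l Fin.↑ˡ k))) (⇒ (E-pres g (C.copy c) (l Fin.↑ˡ k))
            (subst₂ Near (sym (cong toℕ (C.type-copy c))) (sym (C.rank-base l)) nr)))
      where module C = Multiplied n i k

  copies-in-class : ∀ s x k → Σ (Fin k → ∃ (Adjacent Δ δ s x)) λ f →
                    ∀ {c d} → proj₁ (f c) ≋ proj₁ (f d) → c ≡ d
  copies-in-class s x k with f , distinct , ranks , edges ← copies x s k =
    (λ c → R.flag c , ⇒adjacent-off λ j j≢s → sym (R.off c j j≢s))
    , λ {c} {d} p → distinct (trans (sym (R.at c)) (trans (_≋_.at p s) (R.at d)))
    where module R c = Replace x s (f c) (ranks c) (edges c)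

  classes≥2 : ∀ s x → ∃[ y ] ∃[ z ] Adjacent Δ δ s x y × Adjacent Δ δ s x z × ¬ vertex y ≗ vertex z
  classes≥2 s x with f , distinct ← copies-in-class s x 2 =
    proj₁ (f zero) , proj₁ (f (suc zero)) , proj₂ (f zero) , proj₂ (f (suc zero))
    , λ p → contradiction (distinct {zero} {suc zero} (mk≋ p)) λ ()

  building : IsBuilding Δ δ
  building = record
    { δ-cong       = λ {x} {x′} {y} {y′} p q →
        gal⇒δ (δ-irreducible x′ y′) (gal-congˡ (≋-sym (mk≋ p)) (gal-congʳ (≋-sym (mk≋ q)) (δ-gallery x′ y′)))
    ; adjacent-equ = λ s → record
      { refl  = ⇒adjacent (inj₁ ≋-refl)
      ; sym   = λ a → ⇒adjacent-off λ j j≢s → sym (agree-off a j j≢s)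
      ; trans = λ a b → ⇒adjacent-off λ j j≢s → trans (agree-off a j j≢s) (agree-off b j j≢s)
      }
    ; classes≥2    = classes≥2
    ; galleries    = galleries
    }

  enumerate : V → ℕ → V
  enumerate v₀ k with unpair k
  ... | i , a with a ℕₚ.<? size (stage i)
  ...   | yes l = to (ι i) (Fin.fromℕ< l)
  -- A code beyond the size of its stage is sent to the default vertex.
  ...   | no _  = v₀

  enumerate-surjective : ∀ v₀ v → ∃[ k ] enumerate v₀ k ≡ v
  enumerate-surjective v₀ v with i , a , refl ← ι-covers v
    with k , p ← unpair-surjective i (toℕ a) = k , hit
    where
    hit : enumerate v₀ k ≡ to (ι i) a
    hit rewrite p with toℕ a ℕₚ.<? size (stage i)
    ... | yes l = cong (to (ι i)) (Finₚ.fromℕ<-toℕ a l)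
    ... | no ¬l = contradiction (Finₚ.toℕ<n a) ¬l

  module Class (s : Fin (suc n)) (x : MaximalFlag M) where

    Fits : Pred V 0ℓ
    Fits v = rank v ≡ toℕ s × (∀ j → Near (toℕ s) (toℕ j) → E v (vertex x j))

    fits? : Decidable Fits
    fits? v = (rank v ℕₚ.≟ toℕ s) ×-dec Finₚ.all? λ j →
      ((toℕ j ℕₚ.≟ suc (toℕ s)) ⊎-dec (toℕ s ℕₚ.≟ suc (toℕ j))) →-dec E? v (vertex x j)

    -- A flag in the class is determined by its `s`-th vertex, so enumerating vertices enumerates
    -- the class; a vertex that does not fit stands for `x` itself.
    member : V → ∃ (Adjacent Δ δ s x)
    member v with fits? v
    ... | no _        = x , ⇒adjacent (inj₁ ≋-refl)
    ... | yes (p , q) = R.flag , ⇒adjacent-off λ j j≢s → sym (R.off j j≢s)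
      where module R = Replace x s v p q

    member-hits : ∀ y → Adjacent Δ δ s x y → proj₁ (member (vertex y s)) ≋ y
    member-hits y a with fits? (vertex y s)
    ... | yes (p , q) = agree-off⇒≋ R.at λ j j≢s → trans (R.off j j≢s) (agree-off a j j≢s)
      where module R = Replace x s (vertex y s) p q
    ... | no ¬fits = contradiction
          ( ofType y s
          , λ j nr → subst (E (vertex y s)) (sym (agree-off a j λ { refl → near⇒≢ nr refl })) (edge y s j nr))
          ¬fits

    ℕ↔class : Inverse (setoid ℕ) (AdjacencyClass Δ δ s x)
    ℕ↔class = Countable.ℕ↔A (Setoid.isEquivalence (AdjacencyClass Δ δ s x))
      (λ (y , _) (z , _) → Finₚ.all? λ j → vertex y j ≟ vertex z j)
      (λ k → member (enumerate (vertex x zero) k))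
      (λ (y , a) →
        let k , p = enumerate-surjective (vertex x zero) (vertex y s)
        in k , _≋_.at (subst (λ v → proj₁ (member v) ≋ y) (sym p) (member-hits y a)))
      (λ k → let f , distinct = copies-in-class s x k in f , λ p → distinct (mk≋ p))

theorem4p1 : (n : ℕ) → 1 ≤ n → {V : Set} (M : LGraph n V) → HrushovskiLimit M →
    Σ (MaximalFlag M → MaximalFlag M → Group.Carrier (W n)) λ δ →
    IsFlagDistance M δ
    × (∀ δ′ → IsFlagDistance M δ′ → ∀ x y → δ′ x y ≈W δ x y)
    × IsBuilding (maximalFlags M) δ
    × (∀ s x → Inverse (setoid ℕ) (AdjacencyClass (maximalFlags M) δ s x))
theorem4p1 n 1≤n M H = δ , flagDistance , distance-unique , building , Class.ℕ↔class
  where open Limit 1≤n M H
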